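{- The number $9$ is the only odd infinitary superperfect number. That is, if $N$ is an odd positive integer with $\sigma_\infty(\sigma_\infty(N))=2N$, then $N=9$ (and indeed $\sigma_\infty(\sigma_\infty(9))=18$).
   Context: Infinitary divisors. Every divisor of a positive integer $n$ is a $0$-ary divisor of $n$; for $k\ge 0$, a divisor $d$ of $n$ is a $(k+1)$-ary divisor of $n$ if $d$ and $n/d$ have no common $k$-ary divisor other than $1$. For a prime $p$ and $0\le f\le e$, $p^f$ is called an infinitary divisor of $p^e$ if it is an $(e-1)$-ary divisor of $p^e$. Equivalently (a known characterization due to G. L. Cohen), writing $e=\sum_{i\in I}2^i$ and $f=\sum_{j\in J}2^j$ in binary, $p^f$ is an infinitary divisor of $p^e$ iff $J\subseteq I$. For $n=\prod_i p_i^{e_i}$ (distinct primes $p_i$), a divisor $d=\prod_i p_i^{f_i}$ of $n$ is an infinitary divisor of $n$ iff each $p_i^{f_i}$ is an infinitary divisor of $p_i^{e_i}$. Let $\sigma_\infty(n)$ be the sum of the infinitary divisors of $n$; explicitly, if $e_i=\sum_j y_{ij}2^j$ with $y_{ij}\in\{0,1\}$, then $\sigma_\infty(n)=\prod_i\prod_{j:\,y_{ij}=1}(1+p_i^{2^j})$. A positive integer $N$ is called infinitary superperfect if $\sigma_\infty(\sigma_\infty(N))=2N$. -}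

module Defs where

open import Data.Nat using (ℕ; zero; suc; _+_; _*_; _∸_; _^_; _≡ᵇ_; _/_; _%_)
open import Data.Nat.Primality using (prime?)
open import Data.Bool using (Bool; true; false; _∧_; _∨_; not; if_then_else_)
open import Data.List using (List; []; _∷_; foldr; map)
open import Data.List.Base using (upTo)
open import Relation.Nullary.Decidable using (does)

divides? : ℕ → ℕ → Bool
divides? zero    n = n ≡ᵇ 0
divides? (suc d) n = (n % suc d) ≡ᵇ 0

allᵇ : {A : Set} → (A → Bool) → List A → Bool
allᵇ P = foldr (λ x acc → P x ∧ acc) true

range1 : ℕ → List ℕ
range1 n = map suc (upTo n)

karyDiv : ℕ → ℕ → ℕ → Bool
karyDiv zero    d n = divides? d n
karyDiv (suc k) zero    n = false
karyDiv (suc k) (suc d) n =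
  divides? (suc d) n ∧
  allᵇ (λ c → (c ≡ᵇ 1) ∨ not (karyDiv k c (suc d) ∧ karyDiv k c (n / suc d)))
      (range1 (suc d))

valFuel : ℕ → ℕ → ℕ → ℕ
valFuel zero     p n = 0
valFuel (suc fu) zero n = 0
valFuel (suc fu) (suc p) n =
  if divides? (suc p) n ∧ not (n ≡ᵇ 0) then suc (valFuel fu (suc p) (n / suc p)) else 0

val : ℕ → ℕ → ℕ
val p n = valFuel n p n

-- p^f is an infinitary divisor of p^e iff it is an (e-1)-ary divisor of p^e.
-- (For e = 0 this reads as the 0-ary condition, i.e. only f = 0 occurs.)
infPrimePow : ℕ → ℕ → ℕ → Bool
infPrimePow p f e = karyDiv (e ∸ 1) (p ^ f) (p ^ e)

-- d is an infinitary divisor of n (n ≥ 1) iff d ∣ n and for every prime p,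
-- p^{v_p(d)} is an infinitary divisor of p^{v_p(n)}.
-- Primes not dividing n contribute p^0 | p^0, so only primes p ≤ n matter.
isInfDiv : ℕ → ℕ → Bool
isInfDiv d n =
  divides? d n ∧
  allᵇ (λ p → not (does (prime? p)) ∨ infPrimePow p (val p d) (val p n))
      (range1 n)

σ∞ : ℕ → ℕ
σ∞ n = foldr (λ d acc → (if isInfDiv d n then d else 0) + acc) 0 (range1 n)

{-# OPTIONS --safe #-}
module Submission where

-- Every n > 0 is a product of distinct components p^(2^j) and σ∞ n = ∏ (1 + P) over its components P.
-- For odd N with σ∞ (σ∞ N) = 2 N, comparing powers of 2 shows that M = σ∞ N has exactly one odd
-- component Q = q^(2^l); the others are 2^(2^i) for i in a set I of indices. Put G = ∏ 2^(2^i) and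
-- F = ∏ (2^(2^i) + 1), so that ∏ (1 + P) = Q G over the components P of N, and (1 + Q) F = 2 N.
-- If I = {0}, then N = P with 1 + P = 2 Q and 2 P = 3 (1 + Q), whence N = 9.
-- Otherwise I contains some i ≥ 1, and since a divisor of x² + 1 is never ≡ 3 (mod 4), a component
-- P ≡ 1 (mod 4) belongs to every prime dividing 2^(2^i) + 1; such a P satisfies 1 + P = 2 q^b.
-- For l = 0 only one P involves q, the remaining ones being 2^a - 1, and this fails modulo 3.
-- For l ≥ 1 every P has the form 2 q^b - 1 with distinct b. If 0, 1 ∈ I, then 3^(2^k) + 1 = 2 q^b and
-- 5^(2^j) + 1 = 2 q^c contradict each other modulo 3 and 5. If not, F/G and ∏ (1 + 1/P) are too small.

open import Data.Bool using (Bool; true; false; _∧_; _∨_; not; T; if_then_else_)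
import Data.Bool.Properties as Bool
open import Data.Empty using (⊥)
open import Data.List using (List; []; _∷_; map; filter; _++_; foldr)
open import Data.List.Membership.Propositional using (_∈_; find)
open import Data.List.Membership.Propositional.Properties using (∈-map⁺; ∈-map⁻; ∈-upTo⁺; ∈-upTo⁻; ∈-filter⁺; ∈-filter⁻; ∈-++⁺ˡ; ∈-++⁺ʳ; ∈-++⁻; ∈-∃++)
open import Data.List.Membership.Propositional.Properties.WithK using (unique∧set⇒bag)
open import Data.List.Properties using (map-∘)
open import Data.List.Relation.Binary.BagAndSetEquality using (∼bag⇒↭)
open import Data.List.Relation.Binary.Permutation.Propositional using (_↭_; ↭-sym; ↭⇒↭ₛ)
open import Data.List.Relation.Binary.Permutation.Propositional.Properties using (shift; map⁺; All-resp-↭; ∈-resp-↭)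
import Data.List.Relation.Binary.Permutation.Setoid.Properties as SetoidPerm
open import Data.List.Relation.Unary.All as All using (All; []; _∷_)
open import Data.List.Relation.Unary.All.Properties using (¬Any⇒All¬)
open import Data.List.Relation.Unary.AllPairs as AllPairs using ([]; _∷_)
open import Data.List.Relation.Unary.Any using (here; there; any?)
open import Data.List.Relation.Unary.Unique.Propositional using (Unique)
import Data.List.Relation.Unary.Unique.Propositional.Properties as Unique
open import Data.Nat
open import Data.Nat.Coprimality using (Coprime; coprime-divisor)
open import Data.Nat.DivMod
open import Data.Nat.Divisibility
open import Data.Nat.Induction using (<-rec)
open import Data.Nat.ListAction using (sum; product)
open import Data.Nat.ListAction.Properties using (sum-++; sum-↭; ∈⇒∣product; product-↭)
open import Data.Nat.Primality
open import Data.Nat.Properties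
open import Data.Nat.Tactic.RingSolver using (solve-∀)
open import Data.Product using (∃; _×_; _,_; proj₁; proj₂)
open import Data.Sum using (_⊎_; inj₁; inj₂)
open import Data.Unit using (tt)
open import Defs
open import Function using (mk⇔)
open import Relation.Binary.Definitions using (tri<; tri≈; tri>)
open import Relation.Binary.PropositionalEquality
open import Relation.Nullary using (¬_; yes; no; contradiction; ¬?)
open import Relation.Nullary.Decidable using (does; from-yes; from-no; decidable-stable)
open import Data.List.Membership.DecPropositional _≟_ using (_∈?_)

-- Binary digits

isOdd : ℕ → Bool
isOdd zero = false
isOdd (suc n) = not (isOdd n)

bit : ℕ → ℕ → Bool
bit zero n = isOdd n
bit (suc j) n = bit j ⌊ n /2⌋

data Half : ℕ → Set where
  even : ∀ m → Half (m + m)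
  odd  : ∀ m → Half (suc (m + m))

half : ∀ n → Half n
half zero = even 0
half (suc n) with half n
... | even m = odd m
... | odd m = subst Half (cong suc (+-suc m m)) (even (suc m))

isOdd-even : ∀ m → isOdd (m + m) ≡ false
isOdd-even zero = refl
isOdd-even (suc m) rewrite +-suc m m | isOdd-even m = refl

isOdd-odd : ∀ m → isOdd (suc (m + m)) ≡ true
isOdd-odd m rewrite isOdd-even m = refl

⌊even/2⌋ : ∀ m → ⌊ m + m /2⌋ ≡ m
⌊even/2⌋ m = sym (n≡⌊n+n/2⌋ m)

⌊odd/2⌋ : ∀ m → ⌊ suc (m + m) /2⌋ ≡ m
⌊odd/2⌋ m = sym (n≡⌈n+n/2⌉ m)

infix 4 _⊑_
-- This is the condition J ⊆ I of Cohen's criterion, read on binary digits.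
_⊑_ : ℕ → ℕ → Set
f ⊑ e = ∀ j → bit j f ≡ true → bit j e ≡ true

-- Here `false ≡ true` plays the role of falsity, since chaining two conflicting values of one digit
-- produces exactly this equation.
Disjoint : ℕ → ℕ → Set
Disjoint f g = ∀ j → bit j f ≡ true → bit j g ≡ true → false ≡ true

interchange : ∀ a b → (a + a) + (b + b) ≡ (a + b) + (a + b)
interchange = solve-∀

-- Unless both lowest digits are 1, nothing is carried out of the lowest place, so halving commutes
-- with the addition.
no-carry : ∀ f g → (isOdd f ≡ true → isOdd g ≡ true → false ≡ true) →
           isOdd (f + g) ≡ isOdd f ∨ isOdd g × ⌊ f + g /2⌋ ≡ ⌊ f /2⌋ + ⌊ g /2⌋
no-carry f g dis with half f | half g
... | even a | even b rewrite interchange a b | isOdd-even a | isOdd-even b | isOdd-even (a + b)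
  | ⌊even/2⌋ a | ⌊even/2⌋ b | ⌊even/2⌋ (a + b) = refl , refl
... | even a | odd b rewrite +-suc (a + a) (b + b) | interchange a b | isOdd-even a | isOdd-even b | isOdd-even (a + b)
  | ⌊even/2⌋ a | ⌊odd/2⌋ b | ⌊odd/2⌋ (a + b) = refl , refl
... | odd a | even b rewrite interchange a b | isOdd-even a | isOdd-even b | isOdd-even (a + b)
  | ⌊odd/2⌋ a | ⌊even/2⌋ b | ⌊odd/2⌋ (a + b) = refl , refl
... | odd a | odd b with () ← dis (isOdd-odd a) (isOdd-odd b)

bit-+ : ∀ f g → Disjoint f g → ∀ j → bit j (f + g) ≡ bit j f ∨ bit j g
bit-+ f g dis zero = proj₁ (no-carry f g (dis 0))
bit-+ f g dis (suc j) rewrite proj₂ (no-carry f g (dis 0)) = bit-+ ⌊ f /2⌋ ⌊ g /2⌋ (λ i → dis (suc i)) j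

bit-0 : ∀ j → bit j 0 ≡ false
bit-0 zero = refl
bit-0 (suc j) = bit-0 j

nonzero-bit : ∀ n → .{{_ : NonZero n}} → ∃ λ j → bit j n ≡ true
nonzero-bit = <-rec _ go
  where
  go : ∀ n → (∀ {m} → m < n → .{{_ : NonZero m}} → ∃ λ j → bit j m ≡ true) → .{{_ : NonZero n}} → ∃ λ j → bit j n ≡ true
  go n rec with half n
  ... | odd m = 0 , isOdd-odd m
  ... | even m@(suc m′) with j , e ← rec (m<m+n m {m} z<s) = suc j , trans (cong (bit j) (⌊even/2⌋ m)) e

⊑0 : ∀ {f} → f ⊑ 0 → f ≡ 0
⊑0 {zero} _ = refl
⊑0 {suc f} f⊑0 with j , e ← nonzero-bit (suc f) with () ← trans (sym (bit-0 j)) (f⊑0 j e)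

-- The complement `g` is built digit by digit: the lowest digits subtract without a borrow, and the
-- remaining ones come from the halves by induction.
⊑-split : ∀ f e → f ⊑ e → ∃ λ g → f + g ≡ e × Disjoint f g
⊑-split f e = <-rec (λ e → ∀ f → f ⊑ e → ∃ λ g → f + g ≡ e × Disjoint f g) go e f
  where
  go : ∀ e → (∀ {e′} → e′ < e → ∀ f → f ⊑ e′ → ∃ λ g → f + g ≡ e′ × Disjoint f g) → ∀ f → f ⊑ e → ∃ λ g → f + g ≡ e × Disjoint f g
  go e rec f f⊑e with half f | half e
  -- Zero is its own half, so the induction cannot descend here.
  ... | _ | even 0 rewrite ⊑0 f⊑e = 0 , refl , λ j p _ → trans (sym (bit-0 j)) p
  ... | even a | even b@(suc b′)
    with g , a+g≡b , dis ← rec (m<m+n b {b} z<s) a (λ j p → subst (λ z → bit j z ≡ true) (⌊even/2⌋ b) (f⊑e (suc j) (subst (λ z → bit j z ≡ true) (sym (⌊even/2⌋ a)) p)))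
    = g + g , trans (interchange a g) (cong₂ _+_ a+g≡b a+g≡b) , λ where
      zero p q → trans (sym (isOdd-even a)) p
      (suc j) p q → dis j (subst (λ z → bit j z ≡ true) (⌊even/2⌋ a) p) (subst (λ z → bit j z ≡ true) (⌊even/2⌋ g) q)
  ... | even a | odd b
    with g , a+g≡b , dis ← rec (s≤s (m≤m+n b b)) a (λ j p → subst (λ z → bit j z ≡ true) (⌊odd/2⌋ b) (f⊑e (suc j) (subst (λ z → bit j z ≡ true) (sym (⌊even/2⌋ a)) p)))
    = suc (g + g) , trans (+-suc (a + a) (g + g)) (cong suc (trans (interchange a g) (cong₂ _+_ a+g≡b a+g≡b))) , λ where
      zero p q → trans (sym (isOdd-even a)) p
      (suc j) p q → dis j (subst (λ z → bit j z ≡ true) (⌊even/2⌋ a) p) (subst (λ z → bit j z ≡ true) (⌊odd/2⌋ g) q)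
  ... | odd a | odd b
    with g , a+g≡b , dis ← rec (s≤s (m≤m+n b b)) a (λ j p → subst (λ z → bit j z ≡ true) (⌊odd/2⌋ b) (f⊑e (suc j) (subst (λ z → bit j z ≡ true) (sym (⌊odd/2⌋ a)) p)))
    = g + g , cong suc (trans (interchange a g) (cong₂ _+_ a+g≡b a+g≡b)) , λ where
      zero p q → trans (sym (isOdd-even g)) q
      (suc j) p q → dis j (subst (λ z → bit j z ≡ true) (⌊odd/2⌋ a) p) (subst (λ z → bit j z ≡ true) (⌊even/2⌋ g) q)
  ... | odd a | even b with () ← trans (sym (isOdd-even b)) (f⊑e 0 (isOdd-odd a))

⊑⇒≤ : ∀ {f e} → f ⊑ e → f ≤ e
⊑⇒≤ {f} {e} f⊑e with g , refl , _ ← ⊑-split f e f⊑e = m≤m+n f g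

⊑-+ˡ : ∀ f g → Disjoint f g → f ⊑ f + g
⊑-+ˡ f g dis j p = trans (bit-+ f g dis j) (cong (_∨ bit j g) p)

isOdd-2* : ∀ m → isOdd (2 * m) ≡ false
isOdd-2* m rewrite +-identityʳ m = isOdd-even m

⌊2*m/2⌋ : ∀ m → ⌊ 2 * m /2⌋ ≡ m
⌊2*m/2⌋ m rewrite +-identityʳ m = ⌊even/2⌋ m

bit-2^ : ∀ j → bit j (2 ^ j) ≡ true
bit-2^ zero = refl
bit-2^ (suc j) = trans (cong (bit j) (⌊2*m/2⌋ (2 ^ j))) (bit-2^ j)

bit-2^⇒≡ : ∀ i j → bit i (2 ^ j) ≡ true → i ≡ j
bit-2^⇒≡ zero zero _ = refl
bit-2^⇒≡ (suc i) zero p with () ← trans (sym (bit-0 i)) p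
bit-2^⇒≡ zero (suc j) p with () ← trans (sym (isOdd-2* (2 ^ j))) p
bit-2^⇒≡ (suc i) (suc j) p = cong suc (bit-2^⇒≡ i j (trans (cong (bit i) (sym (⌊2*m/2⌋ (2 ^ j)))) p))

2^-disjoint : ∀ j f → bit j f ≡ false → Disjoint (2 ^ j) f
2^-disjoint j f q i p r with refl ← bit-2^⇒≡ i j p = trans (sym q) r

bit-split : ∀ j f → bit j f ≡ true → ∃ λ g → f ≡ 2 ^ j + g × bit j g ≡ false
bit-split j f p with g , eq , dis ← ⊑-split (2 ^ j) f (λ i q → subst (λ i → bit i f ≡ true) (sym (bit-2^⇒≡ i j q)) p)
  = g , sym eq , lem (bit j g) refl
  where
  lem : ∀ b → bit j g ≡ b → b ≡ false
  lem false _ = refl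
  lem true q = sym (dis j (bit-2^ j) q)

2^-⊑ : ∀ j f → bit j f ≡ true → 2 ^ j ⊑ f
2^-⊑ j f p i q = subst (λ i → bit i f ≡ true) (sym (bit-2^⇒≡ i j q)) p

-- k-ary divisors of prime powers and valuations

prime⇒2≤ : ∀ {p} → Prime p → 2 ≤ p
prime⇒2≤ pr = nonTrivial⇒n>1 _ {{prime⇒nonTrivial pr}}

prime∤⇒coprime : ∀ {p n} → Prime p → ¬ p ∣ n → Coprime n p
prime∤⇒coprime pr p∤n {d} (d∣n , d∣p) with prime⇒irreducible pr d∣p
... | inj₁ d≡1 = d≡1
... | inj₂ refl = contradiction d∣n p∤n

prime∣prime : ∀ {p q} → Prime p → Prime q → p ∣ q → p ≡ q
prime∣prime pp pq p∣q with prime⇒irreducible pq p∣q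
... | inj₁ refl = contradiction pp ¬prime[1]
... | inj₂ e = e

prime∣^ : ∀ {p} m k → Prime p → p ∣ m ^ k → p ∣ m
prime∣^ m zero pp p∣1 with refl ← ∣1⇒≡1 p∣1 = contradiction pp ¬prime[1]
prime∣^ m (suc k) pp h with euclidsLemma m (m ^ k) pp h
... | inj₁ x = x
... | inj₂ y = prime∣^ m k pp y

∤⇒∣-cancel-^ : ∀ {p d} → Prime p → ¬ p ∣ d → ∀ k {n} → d ∣ p ^ k * n → d ∣ n
∤⇒∣-cancel-^ pr p∤d zero {n} h = subst (_ ∣_) (*-identityˡ n) h
∤⇒∣-cancel-^ {p} {d} pr p∤d (suc k) {n} h =
  ∤⇒∣-cancel-^ pr p∤d k (coprime-divisor (prime∤⇒coprime pr p∤d) (subst (d ∣_) (*-assoc p (p ^ k) n) h))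

∣p^n : ∀ {p} → Prime p → ∀ n {c} → c ∣ p ^ n → ∃ λ h → c ≡ p ^ h
∣p^n pr zero h = 0 , ∣1⇒≡1 h
∣p^n {p} pr (suc n) {c} h with p ∣? c
... | no p∤c = ∣p^n pr n (coprime-divisor (prime∤⇒coprime pr p∤c) h)
... | yes (divides c′ refl) with k , refl ← ∣p^n pr n {c′} (*-cancelˡ-∣ p {{prime⇒nonZero pr}} (subst (_∣ p ^ suc n) (*-comm c′ p) h))
  = suc k , *-comm (p ^ k) p

^-∣⇒≤ : ∀ {p} → 2 ≤ p → ∀ a b → p ^ a ∣ p ^ b → a ≤ b
^-∣⇒≤ {p} 2≤p a b h with a ≤? b
... | yes a≤b = a≤b
... | no a≰b = contradiction (∣⇒≤ {{m^n≢0 p b {{>-nonZero (<-trans z<s 2≤p)}}}} h) (<⇒≱ (^-monoʳ-< p 2≤p (≰⇒> a≰b)))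

^-injective : ∀ {p} → 2 ≤ p → ∀ a b → p ^ a ≡ p ^ b → a ≡ b
^-injective 2≤p a b e = ≤-antisym (^-∣⇒≤ 2≤p a b (∣-reflexive e)) (^-∣⇒≤ 2≤p b a (∣-reflexive (sym e)))

∧-true : ∀ {a b} → a ∧ b ≡ true → a ≡ true × b ≡ true
∧-true {true} e = refl , e

allᵇ⇒ : ∀ {A : Set} (P : A → Bool) xs → allᵇ P xs ≡ true → ∀ {x} → x ∈ xs → P x ≡ true
allᵇ⇒ P (x ∷ xs) e (here refl) = proj₁ (∧-true e)
allᵇ⇒ P (x ∷ xs) e (there m) = allᵇ⇒ P xs (proj₂ (∧-true {P x} e)) m

allᵇ⇐ : ∀ {A : Set} (P : A → Bool) xs → (∀ {x} → x ∈ xs → P x ≡ true) → allᵇ P xs ≡ true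
allᵇ⇐ P [] h = refl
allᵇ⇐ P (x ∷ xs) h rewrite h (here refl) = allᵇ⇐ P xs (λ m → h (there m))

∈-range1⁺ : ∀ {n d} → 0 < d → d ≤ n → d ∈ range1 n
∈-range1⁺ {n} {suc d} _ d<n = ∈-map⁺ suc (∈-upTo⁺ d<n)

∈-range1⁻ : ∀ {n d} → d ∈ range1 n → 0 < d × d ≤ n
∈-range1⁻ {n} m with x , x∈ , refl ← ∈-map⁻ suc m = z<s , ∈-upTo⁻ x∈

≡ᵇ-true⇒≡ : ∀ m n → (m ≡ᵇ n) ≡ true → m ≡ n
≡ᵇ-true⇒≡ m n e = ≡ᵇ⇒≡ m n (subst T (sym e) tt)

≡⇒≡ᵇ-true : ∀ {m n} → m ≡ n → (m ≡ᵇ n) ≡ true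
≡⇒≡ᵇ-true {zero} refl = refl
≡⇒≡ᵇ-true {suc m} refl = ≡⇒≡ᵇ-true {m} refl

divides?⇒∣ : ∀ d n → divides? d n ≡ true → d ∣ n
divides?⇒∣ zero n e rewrite ≡ᵇ-true⇒≡ n 0 e = ∣-refl
divides?⇒∣ (suc d) n e = m%n≡0⇒n∣m n (suc d) (≡ᵇ-true⇒≡ _ 0 e)

∣⇒divides? : ∀ d n → d ∣ n → divides? d n ≡ true
∣⇒divides? zero n h rewrite 0∣⇒≡0 h = refl
∣⇒divides? (suc d) n h = ≡⇒≡ᵇ-true (n∣m⇒m%n≡0 n (suc d) h)

¬true⇒false : ∀ {b} → ¬ b ≡ true → b ≡ false
¬true⇒false {true} h = contradiction refl h
¬true⇒false {false} h = refl

karyDiv⇒∣ : ∀ k d n → karyDiv k d n ≡ true → d ∣ n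
karyDiv⇒∣ zero d n e = divides?⇒∣ d n e
karyDiv⇒∣ (suc k) (suc d) n e = divides?⇒∣ (suc d) n (proj₁ (∧-true e))

-- The Boolean test runs over 1, ..., `d` only; this suffices because a `k`-ary divisor of `d`
-- divides `d` and hence lies in that range.
karyDiv-suc⇒ : ∀ k d n .{{_ : NonZero d}} → karyDiv (suc k) d n ≡ true →
  ∀ c → 0 < c → karyDiv k c d ≡ true → karyDiv k c (n / d) ≡ true → c ≡ 1
karyDiv-suc⇒ k d@(suc _) n e c 0<c h₁ h₂ = lem (c ≡ᵇ 1) refl
    (allᵇ⇒ (λ c → (c ≡ᵇ 1) ∨ not (karyDiv k c d ∧ karyDiv k c (n / d))) (range1 d)
      (proj₂ (∧-true {divides? d n} e)) (∈-range1⁺ 0<c (∣⇒≤ (karyDiv⇒∣ k c d h₁))))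
  where
  lem : ∀ b → (c ≡ᵇ 1) ≡ b → b ∨ not (karyDiv k c d ∧ karyDiv k c (n / d)) ≡ true → c ≡ 1
  lem true q _ = ≡ᵇ-true⇒≡ c 1 q
  lem false q r rewrite h₁ | h₂ with () ← r

karyDiv-suc⇐ : ∀ k d n .{{_ : NonZero d}} → d ∣ n →
  (∀ c → karyDiv k c d ≡ true → karyDiv k c (n / d) ≡ true → c ≡ 1) → karyDiv (suc k) d n ≡ true
karyDiv-suc⇐ k d@(suc _) n d∣n h rewrite ∣⇒divides? d n d∣n = allᵇ⇐ _ (range1 d) (λ {c} _ → lem c (karyDiv k c d) (karyDiv k c (n / d)) refl refl)
  where
  lem : ∀ c a b → karyDiv k c d ≡ a → karyDiv k c (n / d) ≡ b → (c ≡ᵇ 1) ∨ not (a ∧ b) ≡ true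
  lem c true true p q rewrite h c p q = refl
  lem c false b p q with c ≡ᵇ 1
  ... | true = refl
  ... | false = refl
  lem c true false p q with c ≡ᵇ 1
  ... | true = refl
  ... | false = refl

m*n/m≡n : ∀ m n .{{_ : NonZero m}} → m * n / m ≡ n
m*n/m≡n m n = trans (/-congˡ (*-comm m n)) (m*n/n≡m n m)

^-/ : ∀ p f g .{{_ : NonZero (p ^ f)}} → p ^ (f + g) / p ^ f ≡ p ^ g
^-/ p f g = trans (/-congˡ (^-distribˡ-+-* p f g)) (m*n/m≡n (p ^ f) (p ^ g))

^≡1⇒≡0 : ∀ {p} → 2 ≤ p → ∀ a → p ^ a ≡ 1 → a ≡ 0
^≡1⇒≡0 2≤p a e = ^-injective 2≤p a 0 e

0<^ : ∀ {p} → Prime p → ∀ n → 0 < p ^ n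
0<^ {p} pr n = >-nonZero⁻¹ (p ^ n) {{m^n≢0 p n {{prime⇒nonZero pr}}}}

module _ {p : ℕ} (pr : Prime p) where
  private
    instance
      p≢0 : NonZero p
      p≢0 = prime⇒nonZero pr
    2≤p = prime⇒2≤ pr

  mutual
    -- The exponents f and e - f are smaller than e unless f ∈ {0, e}, so that the
    -- induction hypothesis turns "no common k-ary divisor" into "no common binary digit".
    karyDiv-^⇒⊑ : ∀ k f e → e ≤ suc k → karyDiv k (p ^ f) (p ^ e) ≡ true → f ⊑ e
    karyDiv-^⇒⊑ k f e e≤ h with m≤n⇒∃[o]m+o≡n (^-∣⇒≤ 2≤p f e (karyDiv⇒∣ k (p ^ f) (p ^ e) h))
    karyDiv-^⇒⊑ k zero e e≤ h | g , _ = λ j q → contradiction (trans (sym (bit-0 j)) q) λ ()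
    karyDiv-^⇒⊑ k f@(suc _) .(f + 0) e≤ h | zero , refl = λ j q → subst (λ z → bit j z ≡ true) (sym (+-identityʳ f)) q
    karyDiv-^⇒⊑ zero (suc zero) .(1 + suc g) (s≤s ()) h | suc g , refl
    karyDiv-^⇒⊑ zero (suc (suc f)) .(suc (suc f) + suc g) (s≤s ()) h | suc g , refl
    karyDiv-^⇒⊑ (suc k) f@(suc f′) .(f + g) e≤ h | g@(suc g′) , refl = ⊑-+ˡ f g dis
      where
      f≤ : f ≤ suc k
      f≤ = ≤-trans (m≤m+n f g′) (≤-pred (subst (_≤ suc (suc k)) (+-suc f g′) e≤))
      g≤ : g ≤ suc k
      g≤ = ≤-trans (m≤n+m g f′) (≤-pred e≤)
      dis : Disjoint f g
      -- A shared digit `j` makes `p ^ (2 ^ j)` a common `k`-ary divisor of `p ^ f` and `p ^ g`, and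
      -- this number is not 1.
      dis j bf bg = contradiction (^≡1⇒≡0 2≤p (2 ^ j) (karyDiv-suc⇒ k (p ^ f) (p ^ (f + g)) {{m^n≢0 p f}} h (p ^ (2 ^ j)) (0<^ pr (2 ^ j))
                (⊑⇒karyDiv-^ k (2 ^ j) f f≤ (2^-⊑ j f bf))
                (subst (λ z → karyDiv k (p ^ (2 ^ j)) z ≡ true) (sym (^-/ p f g {{m^n≢0 p f}})) (⊑⇒karyDiv-^ k (2 ^ j) g g≤ (2^-⊑ j g bg)))))
                (≢-nonZero⁻¹ (2 ^ j) {{m^n≢0 2 j}})

    -- A common `k`-ary divisor of `p ^ f` and `p ^ g` is some `p ^ h` with the digits of `h` in
    -- both `f` and `g`; disjointness leaves only `h` = 0. With the converse, the bound `e ≤ suc k`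
    -- expresses that the `k`-ary divisors of `p ^ e` no longer change from `k` = `e` - 1 on.
    ⊑⇒karyDiv-^ : ∀ k f e → e ≤ suc k → f ⊑ e → karyDiv k (p ^ f) (p ^ e) ≡ true
    ⊑⇒karyDiv-^ zero f e _ f⊑e = ∣⇒divides? (p ^ f) (p ^ e) (m≤n⇒m^n∣ (⊑⇒≤ f⊑e))
      where
      m≤n⇒m^n∣ : f ≤ e → p ^ f ∣ p ^ e
      m≤n⇒m^n∣ f≤e with g , refl ← m≤n⇒∃[o]m+o≡n f≤e rewrite ^-distribˡ-+-* p f g = m∣m*n (p ^ g)
    ⊑⇒karyDiv-^ (suc k) f e e≤ f⊑e with g , refl , dis ← ⊑-split f e f⊑e =
      karyDiv-suc⇐ k (p ^ f) (p ^ (f + g)) {{m^n≢0 p f}} (subst (p ^ f ∣_) (sym (^-distribˡ-+-* p f g)) (m∣m*n (p ^ g)))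
        λ c h₁ h₂ → lem f g dis e≤ c h₁ (subst (λ z → karyDiv k c z ≡ true) (^-/ p f g {{m^n≢0 p f}}) h₂)
      where
      lem : ∀ f g → Disjoint f g → f + g ≤ suc (suc k) → ∀ c → karyDiv k c (p ^ f) ≡ true → karyDiv k c (p ^ g) ≡ true → c ≡ 1
      lem zero g _ _ c h₁ _ = ∣1⇒≡1 (karyDiv⇒∣ k c 1 h₁)
      lem (suc _) zero _ _ c _ h₂ = ∣1⇒≡1 (karyDiv⇒∣ k c 1 h₂)
      lem f@(suc f′) g@(suc g′) dis e≤ c h₁ h₂ with ∣p^n pr f (karyDiv⇒∣ k c (p ^ f) h₁)
      ... | zero , refl = refl
      ... | h@(suc _) , refl with j , b ← nonzero-bit h
        with () ← dis j (karyDiv-^⇒⊑ k h f (≤-trans (m≤m+n f g′) (≤-pred (subst (_≤ suc (suc k)) (+-suc f g′) e≤))) h₁ j b)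
                        (karyDiv-^⇒⊑ k h g (≤-trans (m≤n+m g f′) (≤-pred e≤)) h₂ j b)

  infPrimePow⇒⊑ : ∀ f e → infPrimePow p f e ≡ true → f ⊑ e
  infPrimePow⇒⊑ f e = karyDiv-^⇒⊑ (e ∸ 1) f e (m≤n+m∸n e 1)

  ⊑⇒infPrimePow : ∀ f e → f ⊑ e → infPrimePow p f e ≡ true
  ⊑⇒infPrimePow f e = ⊑⇒karyDiv-^ (e ∸ 1) f e (m≤n+m∸n e 1)

  valFuel-unique : ∀ fu a m → a ≤ fu → 0 < m → ¬ p ∣ m → valFuel fu p (p ^ a * m) ≡ a
  valFuel-unique zero zero m _ _ _ = refl
  valFuel-unique (suc fu) a m a≤ 0<m p∤m = lem p refl a a≤ (p ^ a * m) refl (>-nonZero⁻¹ _ {{m*n≢0 (p ^ a) m {{m^n≢0 p a}} {{>-nonZero 0<m}}}})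
    where
    -- `valFuel` unfolds only at a successor base, while `p` is a fixed parameter; hence base and
    -- argument are generalized to variables tied by equations.
    lem : ∀ q → q ≡ p → ∀ a → a ≤ suc fu → ∀ n → n ≡ p ^ a * m → 0 < n → valFuel (suc fu) q n ≡ a
    lem zero refl _ _ _ _ _ with () ← 2≤p
    lem (suc q) refl zero a≤ n@(suc _) e _ with divides? (suc q) n in eq
    ... | false = refl
    ... | true = contradiction (subst (p ∣_) (trans e (*-identityˡ m)) (divides?⇒∣ (suc q) n eq)) p∤m
    lem (suc q) refl (suc a) (s≤s a≤) n@(suc _) e _
      rewrite ∣⇒divides? (suc q) n (subst (p ∣_) (sym (trans e (*-assoc p (p ^ a) m))) (m∣m*n (p ^ a * m)))
      = cong suc (trans (cong (valFuel fu p) (trans (/-congˡ (trans e (*-assoc p (p ^ a) m))) (m*n/m≡n p (p ^ a * m)))) (valFuel-unique fu a m a≤ 0<m p∤m))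

  n<p^n : ∀ n → n < p ^ n
  n<p^n zero = z<s
  n<p^n (suc n) = ≤-trans (s≤s (n<p^n n)) (≤-trans (+-monoˡ-≤ (p ^ n) (0<^ pr n))
      (subst (_≤ p * p ^ n) (cong (p ^ n +_) (+-identityʳ (p ^ n))) (*-monoˡ-≤ (p ^ n) 2≤p)))

  -- The fuel `n` is sufficient because `a` < `p ^ a` ≤ `n`.
  val-unique : ∀ {n} a m → n ≡ p ^ a * m → 0 < m → ¬ p ∣ m → val p n ≡ a
  val-unique a m refl 0<m p∤m = valFuel-unique (p ^ a * m) a m
    (≤-trans (<⇒≤ (n<p^n a)) (m≤m*n (p ^ a) m {{>-nonZero 0<m}})) 0<m p∤m

  val-factor : ∀ n → 0 < n → ∃ λ m → n ≡ p ^ val p n * m × 0 < m × ¬ p ∣ m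
  val-factor n 0<n = let a , m , e , 0<m , p∤m = go n n ≤-refl 0<n in
    m , subst (λ a → n ≡ p ^ a * m) (sym (val-unique a m e 0<m p∤m)) e , 0<m , p∤m
    where
    go : ∀ fu n → n ≤ fu → 0 < n → ∃ λ a → ∃ λ m → n ≡ p ^ a * m × 0 < m × ¬ p ∣ m
    go zero n n≤0 0<n = contradiction 0<n (≤⇒≯ n≤0)
    go (suc fu) n n≤ 0<n with p ∣? n
    ... | no p∤n = 0 , n , sym (*-identityˡ n) , 0<n , p∤n
    ... | yes p∣n@(divides q e)
      with a , m , refl , h ← go fu q (≤-pred (≤-trans (quotient-< p∣n {{prime⇒nonTrivial pr}} {{>-nonZero 0<n}}) n≤))
                                (n≢0⇒n>0 λ q≡0 → <⇒≢ 0<n (sym (trans e (cong (_* p) q≡0))))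
      = suc a , m , trans e (trans (*-comm _ p) (sym (*-assoc p (p ^ a) m))) , h

  val-* : ∀ m n → 0 < m → 0 < n → val p (m * n) ≡ val p m + val p n
  val-* m n 0<m 0<n with m′ , em , 0<m′ , p∤m′ ← val-factor m 0<m | n′ , en , 0<n′ , p∤n′ ← val-factor n 0<n
    = val-unique (val p m + val p n) (m′ * n′)
        (trans (cong₂ _*_ em en) (trans ([m*n]*[o*p]≡[m*o]*[n*p] (p ^ val p m) m′ (p ^ val p n) n′)
           (cong (_* (m′ * n′)) (sym (^-distribˡ-+-* p (val p m) (val p n))))))
        (*-mono-< {0} {m′} {0} {n′} 0<m′ 0<n′) p∤
    where
    p∤ : ¬ p ∣ m′ * n′
    p∤ h with euclidsLemma m′ n′ pr h
    ... | inj₁ x = p∤m′ x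
    ... | inj₂ y = p∤n′ y

  val-^ : ∀ k → val p (p ^ k) ≡ k
  val-^ k = val-unique k 1 (sym (*-identityʳ (p ^ k))) z<s λ h → contradiction (∣1⇒≡1 h) (λ e → contradiction (subst Prime e pr) ¬prime[1])

  val-∤ : ∀ {n} → 0 < n → ¬ p ∣ n → val p n ≡ 0
  val-∤ {n} 0<n p∤n = val-unique 0 n (sym (*-identityˡ n)) 0<n p∤n

-- The propositional form of `isInfDiv`: infinitary divisibility of prime powers is replaced by
-- digit containment, and all primes are covered rather than those up to `n`.
record InfDiv (d n : ℕ) : Set where
  constructor infDiv
  field
    pos : 0 < d
    ∣n : d ∣ n
    vals : ∀ p → Prime p → val p d ⊑ val p n

isInfDiv⇒InfDiv : ∀ d n → 0 < d → 0 < n → isInfDiv d n ≡ true → InfDiv d n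
isInfDiv⇒InfDiv d n 0<d 0<n h = infDiv 0<d d∣n vals
  where
  d∣n = divides?⇒∣ d n (proj₁ (∧-true h))
  vals : ∀ p → Prime p → val p d ⊑ val p n
  vals p pr with p ≤? n
  ... | yes p≤n with prime? p | allᵇ⇒ (λ p → not (does (prime? p)) ∨ infPrimePow p (val p d) (val p n)) (range1 n) (proj₂ (∧-true {divides? d n} h)) (∈-range1⁺ (<-trans z<s (prime⇒2≤ pr)) p≤n)
  ...   | yes _ | q = infPrimePow⇒⊑ pr (val p d) (val p n) q
  ...   | no ¬p | _ = contradiction pr ¬p
  -- A prime above `n` does not divide `d`, so the valuation of `d` is 0 and has no digits.
  vals p pr | no p≰n rewrite val-∤ pr 0<d (λ p∣d → p≰n (∣⇒≤ {{>-nonZero 0<n}} (∣-trans p∣d d∣n))) =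
    λ j q → contradiction (trans (sym (bit-0 j)) q) λ ()

InfDiv⇒isInfDiv : ∀ {d n} → InfDiv d n → isInfDiv d n ≡ true
InfDiv⇒isInfDiv {d} {n} (infDiv 0<d d∣n vals) rewrite ∣⇒divides? d n d∣n = allᵇ⇐ _ (range1 n) λ {p} _ → lem p
  where
  lem : ∀ p → not (does (prime? p)) ∨ infPrimePow p (val p d) (val p n) ≡ true
  lem p with prime? p
  ... | yes pr = ⊑⇒infPrimePow pr (val p d) (val p n) (vals p pr)
  ... | no _ = refl

-- σ∞ as a product over Fermi–Dirac components

0<* : ∀ {m n} → 0 < m → 0 < n → 0 < m * n
0<* {m} {n} p q = *-mono-< {0} {m} {0} {n} p q

∨-trueʳ : ∀ b {c} → c ≡ true → b ∨ c ≡ true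
∨-trueʳ false p = p
∨-trueʳ true p = refl

-- As digit `j` is absent from the valuation of `m`, multiplication by `P` merely switches this
-- digit on, without a carry.
module _ {p j m : ℕ} (pr : Prime p) (0<m : 0 < m) (new : bit j (val p m) ≡ false) where
  private
    P = p ^ (2 ^ j)
    0<P : 0 < P
    0<P = 0<^ pr (2 ^ j)
    instance
      P≢0 : NonZero P
      P≢0 = >-nonZero 0<P

  val-same : ∀ n → 0 < n → val p (P * n) ≡ 2 ^ j + val p n
  val-same n 0<n = trans (val-* pr P n 0<P 0<n) (cong (_+ val p n) (val-^ pr (2 ^ j)))

  val-other : ∀ q → Prime q → q ≢ p → ∀ n → 0 < n → val q (P * n) ≡ val q n
  val-other q qr q≢p n 0<n = trans (val-* qr P n 0<P 0<n)
    (cong (_+ val q n) (val-∤ qr 0<P λ q∣P → q≢p (prime∣prime qr pr (prime∣^ p (2 ^ j) qr q∣P))))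

  bit-new : ∀ a → bit j a ≡ false → ∀ i → bit i (2 ^ j + a) ≡ bit i (2 ^ j) ∨ bit i a
  bit-new a h = bit-+ (2 ^ j) a (2^-disjoint j a h)

  val-⊑ : ∀ q → Prime q → val q m ⊑ val q (P * m)
  val-⊑ q qr i b with q ≟ p
  ... | yes refl = trans (cong (bit i) (val-same m 0<m)) (trans (bit-new (val p m) new i) (∨-trueʳ (bit i (2 ^ j)) b))
  ... | no q≢p = trans (cong (bit i) (val-other q qr q≢p m 0<m)) b

  val-has : bit j (val p (P * m)) ≡ true
  val-has = trans (cong (bit j) (val-same m 0<m)) (trans (bit-new (val p m) new j) (cong (_∨ bit j (val p m)) (bit-2^ j)))

  InfDiv-lacks : ∀ {d} → InfDiv d m → bit j (val p d) ≡ false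
  InfDiv-lacks {d} (infDiv _ _ vals) = ¬true⇒false λ b → contradiction (trans (sym (vals p pr j b)) new) λ ()

  InfDiv-weaken : ∀ {d} → InfDiv d m → InfDiv d (P * m)
  InfDiv-weaken (infDiv 0<d d∣m vals) = infDiv 0<d (∣n⇒∣m*n P d∣m) λ q qr i b → val-⊑ q qr i (vals q qr i b)

  InfDiv-extend : ∀ {d} → InfDiv d m → InfDiv (P * d) (P * m)
  InfDiv-extend {d} D@(infDiv 0<d d∣m vals) = infDiv (0<* 0<P 0<d) (*-monoʳ-∣ P d∣m) vals′
    where
    vals′ : ∀ q → Prime q → val q (P * d) ⊑ val q (P * m)
    vals′ q qr i b with q ≟ p
    ... | no q≢p rewrite val-other q qr q≢p m 0<m | val-other q qr q≢p d 0<d = vals q qr i b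
    ... | yes refl rewrite val-same m 0<m | val-same d 0<d | bit-new (val p m) new i | bit-new (val p d) (InfDiv-lacks D) i with bit i (2 ^ j)
    ...   | true = refl
    ...   | false = vals p pr i b

  -- The cases are whether digit `j` occurs in the valuation of `d`. If absent, `d` already divides
  -- `m`; if present, removing it amounts to dividing `d` by `P`.
  InfDiv-cases : ∀ {d} → InfDiv d (P * m) → InfDiv d m ⊎ ∃ λ d′ → d ≡ P * d′ × InfDiv d′ m
  InfDiv-cases {d} (infDiv 0<d d∣Pm vals) with bit j (val p d) in eq
  ... | false = inj₁ (infDiv 0<d d∣m valsm)
    where
    valsp : val p d ⊑ val p m
    valsp i b with bit i (2 ^ j) in q
    ... | true = contradiction (trans (sym b) (trans (cong (λ i → bit i (val p d)) (bit-2^⇒≡ i j q)) eq)) λ ()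
    ... | false = trans (sym (trans (cong (bit i) (val-same m 0<m)) (trans (bit-new (val p m) new i) (cong (_∨ bit i (val p m)) q)))) (vals p pr i b)
    valsm : ∀ q → Prime q → val q d ⊑ val q m
    valsm q qr with q ≟ p
    ... | yes refl = valsp
    ... | no q≢p = λ i b → trans (cong (bit i) (sym (val-other q qr q≢p m 0<m))) (vals q qr i b)
    d∣m : d ∣ m
    -- The `p`-part of `d` divides that of `m` by digit containment; the `p`-free part `d₀` divides
    -- `P * m`, and all powers of `p` can be cancelled there.
    d∣m with d₀ , ed , _ , p∤d₀ ← val-factor pr d 0<d | m₀ , em , _ ← val-factor pr m 0<m | k , ek ← m≤n⇒∃[o]m+o≡n (⊑⇒≤ valsp)
      = subst₂ _∣_ (sym ed) (sym em) (*-pres-∣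
          (subst (p ^ val p d ∣_) (trans (sym (^-distribˡ-+-* p (val p d) k)) (cong (p ^_) ek)) (m∣m*n (p ^ k)))
          (∤⇒∣-cancel-^ pr p∤d₀ (2 ^ j) (∤⇒∣-cancel-^ pr p∤d₀ (val p m)
            (subst (d₀ ∣_) (trans (cong (P *_) em) (swap P (p ^ val p m) m₀)) (∣-trans (subst (d₀ ∣_) (sym ed) (n∣m*n (p ^ val p d))) d∣Pm)))))
      where
      swap : ∀ a b c → a * (b * c) ≡ b * (a * c)
      swap a b c = trans (sym (*-assoc a b c)) (trans (cong (_* c) (*-comm a b)) (*-assoc b a c))
  ... | true with a , ea , fresh ← bit-split j (val p d) eq | d₀ , ed , 0<d₀ , p∤d₀ ← val-factor pr d 0<d
    = inj₂ (d′ , d≡ , infDiv 0<d′ (*-cancelˡ-∣ P (subst (_∣ P * m) d≡ d∣Pm)) vals′)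
    where
    d′ = p ^ a * d₀
    0<d′ : 0 < d′
    0<d′ = 0<* (0<^ pr a) 0<d₀
    d≡ : d ≡ P * d′
    d≡ = trans ed (trans (cong (_* d₀) (trans (cong (p ^_) ea) (^-distribˡ-+-* p (2 ^ j) a))) (*-assoc P (p ^ a) d₀))
    val-d′ : val p d′ ≡ a
    val-d′ = val-unique pr a d₀ refl 0<d₀ p∤d₀
    vals′ : ∀ q → Prime q → val q d′ ⊑ val q m
    vals′ q qr i b with q ≟ p
    ... | no q≢p = trans (cong (bit i) (sym (val-other q qr q≢p m 0<m)))
          (vals q qr i (trans (cong (bit i) (trans (cong (val q) d≡) (val-other q qr q≢p d′ 0<d′))) b))
    ... | yes refl with bit i (2 ^ j) in r
    ...   | true = contradiction (trans (sym b) (trans (cong₂ bit (bit-2^⇒≡ i j r) val-d′) fresh)) λ ()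
    ...   | false = trans (sym (trans (cong (bit i) (val-same m 0<m)) (trans (bit-new (val p m) new i) (cong (_∨ bit i (val p m)) r))))
              (vals p pr i (trans (cong (bit i) ea) (trans (bit-new a fresh i) (∨-trueʳ (bit i (2 ^ j)) (trans (cong (bit i) (sym val-d′)) b)))))

infDivs : ℕ → List ℕ
infDivs n = filter (λ d → isInfDiv d n Bool.≟ true) (range1 n)

σ∞≡sum : ∀ n → σ∞ n ≡ sum (infDivs n)
σ∞≡sum n = lem (range1 n)
  where
  lem : ∀ ds → foldr (λ d acc → (if isInfDiv d n then d else 0) + acc) 0 ds ≡ sum (filter (λ d → isInfDiv d n Bool.≟ true) ds)
  lem [] = refl
  lem (d ∷ ds) with isInfDiv d n
  ... | true = cong (d +_) (lem ds)
  ... | false = lem ds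

∈infDivs⁺ : ∀ {d n} → 0 < n → InfDiv d n → d ∈ infDivs n
∈infDivs⁺ {d} {n} 0<n D@(infDiv 0<d d∣n _) = ∈-filter⁺ (λ d → isInfDiv d n Bool.≟ true) (∈-range1⁺ 0<d (∣⇒≤ {{>-nonZero 0<n}} d∣n)) (InfDiv⇒isInfDiv D)

∈infDivs⁻ : ∀ {d n} → 0 < n → d ∈ infDivs n → InfDiv d n
∈infDivs⁻ {d} {n} 0<n d∈ with d∈r , h ← ∈-filter⁻ (λ d → isInfDiv d n Bool.≟ true) {xs = range1 n} d∈ =
  isInfDiv⇒InfDiv d n (proj₁ (∈-range1⁻ d∈r)) 0<n h

infDivs-unique : ∀ n → Unique (infDivs n)
infDivs-unique n = Unique.filter⁺ (λ d → isInfDiv d n Bool.≟ true) (Unique.map⁺ suc-injective (Unique.upTo⁺ n))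

sum-map-* : ∀ P ds → sum (map (P *_) ds) ≡ P * sum ds
sum-map-* P [] = sym (*-zeroʳ P)
sum-map-* P (d ∷ ds) = trans (cong (P * d +_) (sum-map-* P ds)) (sym (*-distribˡ-+ P d (sum ds)))

-- The infinitary divisors of `P * m` are those of `m` and their multiples by `P`. The two families
-- are disjoint, because digit `j` is set exactly in the second.
σ∞-step : ∀ {p j m} → Prime p → 0 < m → bit j (val p m) ≡ false → σ∞ (p ^ (2 ^ j) * m) ≡ suc (p ^ (2 ^ j)) * σ∞ m
σ∞-step {p} {j} {m} pr 0<m new = begin
  σ∞ (P * m)                                     ≡⟨ σ∞≡sum (P * m) ⟩
  sum (infDivs (P * m))                          ≡⟨ sum-↭ perm ⟩
  sum (infDivs m ++ map (P *_) (infDivs m))      ≡⟨ sum-++ (infDivs m) _ ⟩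
  sum (infDivs m) + sum (map (P *_) (infDivs m)) ≡⟨ cong (sum (infDivs m) +_) (sum-map-* P (infDivs m)) ⟩
  suc P * sum (infDivs m)                        ≡⟨ cong (suc P *_) (sym (σ∞≡sum m)) ⟩
  suc P * σ∞ m                                   ∎
  where
  open ≡-Reasoning
  P = p ^ (2 ^ j)
  0<P : 0 < P
  0<P = 0<^ pr (2 ^ j)
  0<Pm : 0 < P * m
  0<Pm = 0<* 0<P 0<m
  to : ∀ {d} → d ∈ infDivs (P * m) → d ∈ infDivs m ++ map (P *_) (infDivs m)
  to d∈ with InfDiv-cases {j = j} pr 0<m new (∈infDivs⁻ 0<Pm d∈)
  ... | inj₁ D = ∈-++⁺ˡ (∈infDivs⁺ 0<m D)
  ... | inj₂ (d′ , refl , D) = ∈-++⁺ʳ (infDivs m) (∈-map⁺ (P *_) (∈infDivs⁺ 0<m D))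
  from : ∀ {d} → d ∈ infDivs m ++ map (P *_) (infDivs m) → d ∈ infDivs (P * m)
  from d∈ with ∈-++⁻ (infDivs m) d∈
  ... | inj₁ d∈m = ∈infDivs⁺ 0<Pm (InfDiv-weaken {j = j} pr 0<m new (∈infDivs⁻ 0<m d∈m))
  ... | inj₂ d∈Pm with d′ , d′∈m , refl ← ∈-map⁻ (P *_) d∈Pm = ∈infDivs⁺ 0<Pm (InfDiv-extend {j = j} pr 0<m new (∈infDivs⁻ 0<m d′∈m))
  disjoint : ∀ {d} → ¬ (d ∈ infDivs m × d ∈ map (P *_) (infDivs m))
  disjoint (d∈m , d∈Pm) with d′ , d′∈m , refl ← ∈-map⁻ (P *_) d∈Pm
    with D ← ∈infDivs⁻ 0<m d∈m | D′ ← ∈infDivs⁻ 0<m d′∈m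
    = contradiction (trans (sym (InfDiv-lacks {j = j} pr 0<m new D))
        (val-has {j = j} pr (InfDiv.pos D′) (InfDiv-lacks {j = j} pr 0<m new D′))) λ ()
  perm : infDivs (P * m) ↭ infDivs m ++ map (P *_) (infDivs m)
  perm = ∼bag⇒↭ (unique∧set⇒bag (infDivs-unique (P * m))
    (Unique.++⁺ (infDivs-unique m) (Unique.map⁺ (*-cancelˡ-≡ _ _ P {{>-nonZero 0<P}}) (infDivs-unique m)) disjoint)
    (mk⇔ to from))

Component : ℕ → Set
Component P = ∃ λ p → ∃ λ j → Prime p × P ≡ p ^ (2 ^ j)

record Components (n : ℕ) : Set where
  field
    parts : List ℕ
    comps : All Component parts
    unique : Unique parts
    prod : n ≡ product parts
    σ∞-prod : σ∞ n ≡ product (map suc parts)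

-- A strengthened invariant for `components`: the digit behind a component is remembered, so that a
-- component split off earlier is seen to differ from all later ones.
Occurs : ℕ → ℕ → Set
Occurs n P = ∃ λ p → ∃ λ j → Prime p × P ≡ p ^ (2 ^ j) × bit j (val p n) ≡ true

2^≢0 : ∀ j → 2 ^ j ≢ 0
2^≢0 j = ≢-nonZero⁻¹ (2 ^ j) {{m^n≢0 2 j}}

∣^≢0 : ∀ p k → k ≢ 0 → p ∣ p ^ k
∣^≢0 p zero k≢0 = contradiction refl k≢0
∣^≢0 p (suc k) _ = m∣m*n (p ^ k)

component-base : ∀ {p q i j} → Prime p → Prime q → p ^ (2 ^ i) ≡ q ^ (2 ^ j) → p ≡ q
component-base {p} {q} {i} {j} pr qr e = prime∣prime pr qr (prime∣^ q (2 ^ j) pr (subst (p ∣_) e (∣^≢0 p (2 ^ i) (2^≢0 i))))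

component-index : ∀ {p i j} → Prime p → p ^ (2 ^ i) ≡ p ^ (2 ^ j) → i ≡ j
component-index {i = i} {j} pr e = ^-injective {2} ≤-refl i j (^-injective (prime⇒2≤ pr) (2 ^ i) (2 ^ j) e)

prime-divisor : ∀ n → 1 < n → ∃ λ p → Prime p × p ∣ n
prime-divisor = <-rec _ go
  where
  go : ∀ n → (∀ {m} → m < n → 1 < m → ∃ λ p → Prime p × p ∣ m) → 1 < n → ∃ λ p → Prime p × p ∣ n
  go n rec 1<n with composite? n
  ... | no ¬c = n , ¬composite⇒prime {{n>1⇒nonTrivial 1<n}} ¬c , ∣-refl
  ... | yes (composite {d} d<n d∣n) with p , pr , p∣d ← rec d<n (nonTrivial⇒n>1 d) = p , pr , ∣-trans p∣d d∣n

-- By strong induction: a prime `p` dividing `n` and a digit `j` of its valuation give `n` =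
-- `P * m`, where digit `j` is no longer present in `m`. So `σ∞-step` applies and `P` does not occur
-- in `m`.
components : ∀ n → 0 < n → Components n
components n 0<n = let ps , occ , u , e , s = <-rec _ go n 0<n in
  record { parts = ps ; comps = All.map (λ (p , j , pr , e , _) → p , j , pr , e) occ ; unique = u ; prod = e ; σ∞-prod = s }
  where
  Goal : ℕ → Set
  Goal n = ∃ λ ps → All (Occurs n) ps × Unique ps × n ≡ product ps × σ∞ n ≡ product (map suc ps)
  go : ∀ n → (∀ {m} → m < n → 0 < m → Goal m) → 0 < n → Goal n
  go n rec 0<n with n ≟ 1
  ... | yes refl = [] , [] , [] , refl , refl
  ... | no n≢1 with p , pr , p∣n ← prime-divisor n (≤∧≢⇒< 0<n (≢-sym n≢1))
    with n₀ , en , 0<n₀ , p∤n₀ ← val-factor pr n 0<n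
    with j , b ← nonzero-bit (val p n) {{≢-nonZero λ v≡0 → p∤n₀ (subst (p ∣_) (trans en (trans (cong (λ a → p ^ a * n₀) v≡0) (*-identityˡ n₀))) p∣n)}}
    with a , ea , fresh ← bit-split j (val p n) b
    = let ps , occ , u , e , s = rec m<n 0<m in
    P ∷ ps , (p , j , pr , refl , b) ∷ All.map weaken occ , All.map new occ ∷ u , trans n≡ (cong (P *_) e)
    , trans (cong σ∞ n≡) (trans (σ∞-step {j = j} pr 0<m lacks) (cong (suc P *_) s))
    where
    P = p ^ (2 ^ j)
    m = p ^ a * n₀
    0<m : 0 < m
    0<m = 0<* (0<^ pr a) 0<n₀
    n≡ : n ≡ P * m
    n≡ = trans en (trans (cong (_* n₀) (trans (cong (p ^_) ea) (^-distribˡ-+-* p (2 ^ j) a))) (*-assoc P (p ^ a) n₀))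
    m<n : m < n
    m<n = subst (m <_) (trans (*-comm m P) (sym n≡)) (m<m*n m P {{>-nonZero 0<m}} (1<p^ (2 ^ j) (2^≢0 j)))
      where
      1<p^ : ∀ k → k ≢ 0 → 1 < p ^ k
      1<p^ zero k≢0 = contradiction refl k≢0
      1<p^ (suc k) _ = ≤-trans (prime⇒2≤ pr) (m≤m*n p (p ^ k) {{m^n≢0 p k {{prime⇒nonZero pr}}}})
    lacks : bit j (val p m) ≡ false
    lacks = trans (cong (bit j) (val-unique pr a n₀ refl 0<n₀ p∤n₀)) fresh
    weaken : ∀ {Q} → Occurs m Q → Occurs n Q
    weaken (q , i , qr , eQ , bq) = q , i , qr , eQ , subst (λ n → bit i (val q n) ≡ true) (sym n≡) (val-⊑ {j = j} pr 0<m lacks q qr i bq)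
    new : ∀ {Q} → Occurs m Q → P ≢ Q
    new (q , i , qr , refl , bq) e with refl ← component-base {i = j} {i} pr qr e with refl ← component-index {i = j} {i} pr e =
      contradiction (trans (sym bq) lacks) λ ()

-- Congruences, Fermat numbers and product estimates

remove : ∀ {x xs} → x ∈ xs → Unique xs → ∃ λ ys → xs ↭ x ∷ ys × Unique (x ∷ ys)
remove {x} x∈ u with ys , zs , refl ← ∈-∃++ x∈ = ys ++ zs , shift x ys zs , SetoidPerm.Unique-resp-↭ (setoid ℕ) (↭⇒↭ₛ (shift x ys zs)) u

Odd : ℕ → Set
Odd n = ¬ 2 ∣ n

odd-* : ∀ {m n} → Odd m → Odd n → Odd (m * n)
odd-* {m} {n} om on h with euclidsLemma m n prime[2] h
... | inj₁ x = om x
... | inj₂ y = on y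

odd-∣ : ∀ {m n} → m ∣ n → Odd n → Odd m
odd-∣ m∣n on 2∣m = on (∣-trans 2∣m m∣n)

odd⇒mod4 : ∀ {n} → Odd n → n % 4 ≡ 1 ⊎ n % 4 ≡ 3
odd⇒mod4 {n} on with n % 4 in e | m%n<n n 4
... | 0 | _ = contradiction (∣-trans (divides 2 refl) (m%n≡0⇒n∣m n 4 e)) on
... | 1 | _ = inj₁ refl
... | 2 | _ = contradiction (∣n∣m%n⇒∣m (divides 2 refl) (subst (2 ∣_) (sym e) ∣-refl)) on
... | 3 | _ = inj₂ refl
... | suc (suc (suc (suc _))) | s≤s (s≤s (s≤s (s≤s ())))

odd⇒2∣suc : ∀ {n} → Odd n → 2 ∣ suc n
odd⇒2∣suc {n} on with n % 2 in e | m%n<n n 2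
... | 0 | _ = contradiction (m%n≡0⇒n∣m n 2 e) on
... | 1 | _ = m%n≡0⇒n∣m (suc n) 2 (trans (%-distribˡ-+ 1 n 2) (cong (λ r → (1 + r) % 2) e))
... | suc (suc _) | s≤s (s≤s ())

mod-* : ∀ d .{{_ : NonZero d}} m n {a b} → m % d ≡ a → n % d ≡ b → (m * n) % d ≡ (a * b) % d
mod-* d m n refl refl = %-distribˡ-* m n d

mod-suc : ∀ d .{{_ : NonZero d}} n {a} → n % d ≡ a → suc n % d ≡ suc a % d
mod-suc d n refl = trans (%-distribˡ-+ 1 n d) (trans (cong (λ r → (1 % d + r) % d) (sym (m%n%n≡m%n n d))) (sym (%-distribˡ-+ 1 (n % d) d)))

mod4≡1-^ : ∀ m k → m % 4 ≡ 1 → (m ^ k) % 4 ≡ 1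
mod4≡1-^ m zero e = refl
mod4≡1-^ m (suc k) e = mod-* 4 m (m ^ k) e (mod4≡1-^ m k e)

odd-square-mod4 : ∀ {n} → Odd n → (n * n) % 4 ≡ 1
odd-square-mod4 {n} on with odd⇒mod4 on
... | inj₁ e = mod-* 4 n n e e
... | inj₂ e = mod-* 4 n n e e

^-2^suc : ∀ m j → m ^ (2 ^ suc j) ≡ m ^ (2 ^ j) * m ^ (2 ^ j)
^-2^suc m j = trans (cong (λ k → m ^ (2 ^ j + k)) (+-identityʳ (2 ^ j))) (^-distribˡ-+-* m (2 ^ j) (2 ^ j))

-- Descent: x may be taken even and below n, and then the cofactor of n in x² + 1 is smaller than n
-- and again ≡ 3 (mod 4).
mod4≡3⇒∤x²+1 : ∀ n → n % 4 ≡ 3 → ∀ x → ¬ n ∣ suc (x * x)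
mod4≡3⇒∤x²+1 = <-rec _ go
  where
  go : ∀ n → (∀ {m} → m < n → m % 4 ≡ 3 → ∀ x → ¬ m ∣ suc (x * x)) → n % 4 ≡ 3 → ∀ x → ¬ n ∣ suc (x * x)
  go 0 rec () x h
  go n@(suc n₀) rec n%4 x h = below (x % n) (m%n<n x n) reduced
    where
    expand : ∀ r k n → suc ((r + k * n) * (r + k * n)) ≡ (2 * r * k + k * k * n) * n + suc (r * r)
    expand = solve-∀
    reduced : n ∣ suc (x % n * (x % n))
    reduced = ∣m+n∣m⇒∣n (subst (n ∣_) (trans (cong (λ z → suc (z * z)) (m≡m%n+[m/n]*n x n)) (expand (x % n) (x / n) n)) h) (n∣m*n (2 * (x % n) * (x / n) + x / n * (x / n) * n))
    quotient-mod4 : ∀ m → (m * n) % 4 ≡ 1 → m % 4 ≡ 3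
    quotient-mod4 m e with m % 4 in em | m%n<n m 4
    ... | 3 | _ = refl
    ... | 0 | _ with () ← trans (sym e) (mod-* 4 m n em n%4)
    ... | 1 | _ with () ← trans (sym e) (mod-* 4 m n em n%4)
    ... | 2 | _ with () ← trans (sym e) (mod-* 4 m n em n%4)
    ... | suc (suc (suc (suc _))) | s≤s (s≤s (s≤s (s≤s ())))
    even-below : ∀ y → y < n → 2 ∣ y → ¬ n ∣ suc (y * y)
    even-below y y<n (divides z refl) n∣@(divides m e) = rec m<n (quotient-mod4 m (trans (cong (_% 4) (sym e)) (trans (cong (_% 4) (sq z)) ([m+kn]%n≡m%n 1 (z * z) 4)))) (z * 2) (divides n (trans e (*-comm m n)))
      where
      sq : ∀ z → suc (z * 2 * (z * 2)) ≡ 1 + z * z * 4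
      sq = solve-∀
      1<pred : ∀ k → suc k % 4 ≡ 3 → 1 < k
      1<pred (suc (suc _)) _ = s≤s (s≤s z≤n)
      m<n : m < n
      -- Here m n = y² + 1 ≤ (n - 1)² + 1 < n², the last step because n ≥ 3.
      m<n = *-cancelʳ-< n m n (subst (_< n * n) e (≤-trans (s≤s (s≤s (*-mono-≤ (≤-pred y<n) (≤-pred y<n))))
              (subst (2 + n₀ * n₀ ≤_) (sq′ n₀) (+-monoˡ-≤ (n₀ * n₀) {2} {1 + (n₀ + n₀)} (s≤s (≤-trans (<⇒≤ (1<pred n₀ n%4)) (m≤m+n n₀ n₀)))))))
        where
        sq′ : ∀ a → suc (a + a) + a * a ≡ suc a * suc a
        sq′ = solve-∀
    below : ∀ r → r < n → ¬ n ∣ suc (r * r)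
    below r r<n n∣ with 2 ∣? r
    ... | yes 2∣r = even-below r r<n 2∣r n∣
    -- An odd `r` is replaced by `s` = `n` - `r`, which is even as `n` is odd, and whose square
    -- agrees with that of `r` modulo `n`.
    ... | no or with s , r+s≡n ← m≤n⇒∃[o]m+o≡n (<⇒≤ r<n) = even-below s s<n 2∣s n∣s
      where
      odd-n : Odd n
      odd-n 2∣n = contradiction (subst (2 ∣_) n%4 (%-presˡ-∣ 2∣n (divides 2 refl))) (λ { (divides (suc (suc _)) ()) ; (divides 1 ()) })
      s<n : s < n
      s<n = subst (s <_) r+s≡n (m<n+m s {r} (n≢0⇒n>0 λ { refl → or (divides 0 refl) }))
      2∣s : 2 ∣ s
      2∣s with 2 ∣? s
      ... | yes p = p
      ... | no os = contradiction (subst (2 ∣_) (trans (cong suc (+-suc r s)) (cong (λ k → 2 + k) r+s≡n)) (∣m∣n⇒∣m+n (odd⇒2∣suc or) (odd⇒2∣suc os)))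
                     λ h → odd-n (∣m+n∣m⇒∣n h ∣-refl)
      move : ∀ r s → (r + s) * s + suc (r * r) ≡ (r + s) * r + suc (s * s)
      move = solve-∀
      n∣s : n ∣ suc (s * s)
      n∣s = ∣m+n∣m⇒∣n (subst (n ∣_) (subst (λ k → k * s + suc (r * r) ≡ k * r + suc (s * s)) r+s≡n (move r s)) (∣m∣n⇒∣m+n (m∣m*n s) n∣)) (m∣m*n r)

odd∣x²+1⇒mod4≡1 : ∀ {n} x → Odd n → n ∣ suc (x * x) → n % 4 ≡ 1
odd∣x²+1⇒mod4≡1 {n} x on h with odd⇒mod4 on
... | inj₁ e = e
... | inj₂ e = contradiction h (mod4≡3⇒∤x²+1 n e x)

-- E i + 1 is the i-th Fermat number.
E : ℕ → ℕ
E i = 2 ^ (2 ^ i)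

2∣E : ∀ i → 2 ∣ E i
2∣E i = ∣^≢0 2 (2 ^ i) (2^≢0 i)

odd-fermat : ∀ i → Odd (suc (E i))
odd-fermat i h = contradiction (∣1⇒≡1 (∣m+n∣m⇒∣n (subst (2 ∣_) (+-comm 1 (E i)) h) (2∣E i))) λ ()

0<E : ∀ i → 0 < E i
0<E i = 0<^ prime[2] (2 ^ i)

-- For positive index `E i` is a square, so the Fermat number has the form x² + 1.
fermat-mod4 : ∀ {p i} → 1 ≤ i → p ∣ suc (E i) → p % 4 ≡ 1
fermat-mod4 {p} {suc i} _ h = odd∣x²+1⇒mod4≡1 (E i) (odd-∣ h (odd-fermat (suc i))) (subst (λ z → p ∣ suc z) (^-2^suc 2 i) h)

-- By repeated factoring of x² - 1, the number E j - 1 is a multiple of E i + 1. A common `p` thus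
-- divides (E j + 1) - (E j - 1) = 2, but Fermat numbers are odd.
fermat-coprime : ∀ {p i j} → Prime p → i < j → p ∣ suc (E i) → ¬ p ∣ suc (E j)
fermat-coprime {p} {i} {j} pr i<j hi hj with k , refl ← m≤n⇒∃[o]m+o≡n i<j = contradiction (∣m+n∣m⇒∣n (subst (p ∣_) (trans (cong suc (proj₁ (proj₂ (higher k)))) (+-comm 2 (proj₁ (higher k)))) hj) (proj₂ (proj₂ (higher k)))) λ p∣2 → odd-fermat i (subst (_∣ suc (E i)) (prime∣prime pr prime[2] p∣2) hi)
  where
  higher : ∀ k → ∃ λ y → E (suc i + k) ≡ suc y × p ∣ y
  higher zero rewrite +-identityʳ i with E i in e | ^-2^suc 2 i
  ... | zero | _ = contradiction (sym e) (<⇒≢ (0<E i))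
  ... | suc x | sq = x * suc (suc x) , trans sq (lem x) , ∣n⇒∣m*n x hi
    where
    lem : ∀ x → suc x * suc x ≡ suc (x * suc (suc x))
    lem = solve-∀
  higher (suc k) with y , e , p∣y ← higher k = y * suc (suc y) , trans (cong E (+-suc (suc i) k)) (trans (^-2^suc 2 (suc i + k)) (trans (cong₂ _*_ e e) (lem y))) , ∣m⇒∣m*n _ p∣y
    where
    lem : ∀ x → suc x * suc x ≡ suc (x * suc (suc x))
    lem = solve-∀

-- Estimates for products over distinct indices

remove-bound : ∀ {r k xs ys} → xs ↭ r ∷ ys → Unique (r ∷ ys) → All (λ i → r ≤ i × i < r + suc k) xs → All (λ i → suc r ≤ i × i < suc r + k) ys
remove-bound {r} {k} {ys = ys} perm (r∉ys ∷ _) bounds with _ ∷ bs ← All-resp-↭ perm bounds =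
  All.zipWith (λ {i} (r≢i , r≤i , i<) → ≤∧≢⇒< r≤i r≢i , subst (i <_) (+-suc r k) i<) (r∉ys , bs)

keep-bound : ∀ {r k xs} → ¬ r ∈ xs → All (λ i → r ≤ i × i < r + suc k) xs → All (λ i → suc r ≤ i × i < suc r + k) xs
keep-bound {r} {k} r∉ bounds = All.tabulate λ {i} i∈ → let r≤i , i< = All.lookup bounds i∈ in
  ≤∧≢⇒< r≤i (λ { refl → r∉ i∈ }) , subst (i <_) (+-suc r k) i<

no-room : ∀ {r xs} → All (λ i → r ≤ i × i < r + 0) xs → xs ≡ []
no-room [] = refl
no-room {r} ((r≤i , i<) ∷ _) = contradiction (≤-trans i< (subst (_≤ _) (sym (+-identityʳ r)) r≤i)) (<-irrefl refl)

fermat : ℕ → ℕ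
fermat i = suc (E i)

product-map-↭ : ∀ (f : ℕ → ℕ) {xs ys} → xs ↭ ys → product (map f xs) ≡ product (map f ys)
product-map-↭ f p = product-↭ (map⁺ f p)

-- ∏_{i ≥ r} (1 + 1/x^(2^(i - r))) telescopes to x / (x - 1), where x = E r.
fermat-product-range : ∀ k r I → Unique I → All (λ i → r ≤ i × i < r + k) I →
  E r * product (map fermat I) ≤ product (map fermat I) + E r * product (map E I)
fermat-product-range zero r I u b rewrite no-room b = m≤n+m (E r * 1) 1
fermat-product-range (suc k) r I u b with r ∈? I
... | yes r∈ = let J , perm , u′ = remove r∈ u in
  subst₂ (λ F G → x * F ≤ F + x * G) (sym (product-map-↭ fermat perm)) (sym (product-map-↭ E perm))
    (step x (product (map fermat J)) (product (map E J))
      (subst (λ z → z * product (map fermat J) ≤ product (map fermat J) + z * product (map E J)) (^-2^suc 2 r)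
        (fermat-product-range k (suc r) J (AllPairs.tail u′) (remove-bound perm u′ b))))
  where
  x = E r
  step : ∀ x F G → x * x * F ≤ F + x * x * G → x * (suc x * F) ≤ suc x * F + x * (x * G)
  step x F G h = subst₂ _≤_ (l x F) (r′ x F G) (+-monoʳ-≤ (x * F) h)
    where
    l : ∀ x F → x * F + x * x * F ≡ x * (suc x * F)
    l = solve-∀
    r′ : ∀ x F G → x * F + (F + x * x * G) ≡ suc x * F + x * (x * G)
    r′ = solve-∀
-- If `r` is missing, the bound x²/(x² - 1) for the higher indices is weakened to x/(x - 1); this is
-- checked after multiplication by x + 1.
... | no r∉ = step (E r) (product (map fermat I)) (product (map E I))
    (subst (λ z → z * product (map fermat I) ≤ product (map fermat I) + z * product (map E I)) (^-2^suc 2 r)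
      (fermat-product-range k (suc r) I u (keep-bound r∉ b)))
  where
  step : ∀ x F G → x * x * F ≤ F + x * x * G → x * F ≤ F + x * G
  step x F G h = *-cancelˡ-≤ (suc x) (subst₂ _≤_ (l x F) (r′ x F G) (≤-trans (+-monoʳ-≤ (x * F) h) (m≤m+n _ (x * G))))
    where
    l : ∀ x F → x * F + x * x * F ≡ suc x * (x * F)
    l = solve-∀
    r′ : ∀ x F G → x * F + (F + x * x * G) + x * G ≡ suc x * (F + x * G)
    r′ = solve-∀

max : List ℕ → ℕ
max [] = 0
max (x ∷ xs) = x ⊔ max xs

≤max : ∀ {x xs} → x ∈ xs → x ≤ max xs
≤max {x} {_ ∷ xs} (here refl) = m≤m⊔n x (max xs)
≤max {x} {y ∷ xs} (there m) = ≤-trans (≤max m) (m≤n⊔m y (max xs))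

in-range : ∀ {r xs} → All (r ≤_) xs → All (λ i → r ≤ i × i < r + suc (max xs)) xs
in-range {r} {xs} b = All.tabulate λ i∈ → All.lookup b i∈ , ≤-trans (s≤s (≤max i∈)) (m≤n+m (suc (max xs)) r)

fermat-product : ∀ r I → Unique I → All (r ≤_) I → E r * product (map fermat I) ≤ product (map fermat I) + E r * product (map E I)
fermat-product r I u b = fermat-product-range (suc (max I)) r I u (in-range b)

-- In terms of the difference: b (D - P) ≤ c K gives a c (D - P) ≤ c K, and `c` cancels. When D ≤ P
-- the claim is immediate.
scale-≤ : ∀ {a b D P c K} → .{{_ : NonZero c}} → a * c ≤ b → b * D ≤ b * P + c * K → a * D ≤ a * P + K
scale-≤ {a} {b} {D} {P} {c} {K} ac≤b h with ≤-total D P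
... | inj₁ D≤P = ≤-trans (*-monoʳ-≤ a D≤P) (m≤m+n (a * P) K)
... | inj₂ P≤D with δ , refl ← m≤n⇒∃[o]m+o≡n P≤D = subst (_≤ a * P + K) (sym (*-distribˡ-+ a P δ)) (+-monoʳ-≤ (a * P)
    (*-cancelˡ-≤ c (≤-trans (subst (_≤ b * δ) (lem c a δ) (*-monoˡ-≤ δ ac≤b)) (+-cancelˡ-≤ (b * P) _ _ (subst (_≤ b * P + c * K) (*-distribˡ-+ b P δ) h)))))
  where
  lem : ∀ c a δ → a * c * δ ≡ c * (a * δ)
  lem = solve-∀

module _ (q : ℕ) (3≤q : 3 ≤ q) where
  double : ℕ → ℕ
  double b = 2 * q ^ b

  double-1 : ℕ → ℕ
  double-1 b = 2 * q ^ b ∸ 1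

  -- ∏_{b ≥ r} (1 - 1/(2q^b)) ≥ 1 - 3/(4q^r).
  power-product-range : ∀ k r bs → Unique bs → All (λ b → r ≤ b × b < r + k) bs →
    4 * q ^ r * product (map double bs) ≤ 4 * q ^ r * product (map double-1 bs) + 3 * product (map double bs)
  power-product-range zero r bs u b rewrite no-room b = m≤m+n (4 * q ^ r * 1) 3
  power-product-range (suc k) r bs u b = by-cases
    where
    y = q ^ r
    -- As q ≥ 3, the loss 3/(4qy) allowed to the indices above `r` is at most 1/(4y).
    tighten : ∀ D P → 4 * (q * y) * D ≤ 4 * (q * y) * P + 3 * D → 4 * y * D ≤ 4 * y * P + D
    tighten D P = scale-≤ {4 * y} {4 * (q * y)} {D} {P} {3} {D} (subst (_≤ 4 * (q * y)) (lem y) (*-monoʳ-≤ 4 (*-monoˡ-≤ y 3≤q)))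
      where
      lem : ∀ y → 4 * (3 * y) ≡ 4 * y * 3
      lem = solve-∀
    -- The factor at `r` is 1 - 1/(2y), where 2y = t + 1, and the losses add up to 1/(2y) + 1/(4y) =
    -- 3/(4y).
    step : ∀ t y D P → 2 * y ≡ suc t → 4 * y * D ≤ 4 * y * P + D → 4 * y * (2 * y * D) ≤ 4 * y * (t * P) + 3 * (2 * y * D)
    step t y D P e h = begin
      4 * y * (2 * y * D)                        ≡⟨ cong (λ z → 4 * y * (z * D)) e ⟩
      4 * y * (suc t * D)                        ≡⟨ l₁ t y D ⟩
      t * (4 * y * D) + 4 * y * D                ≤⟨ +-monoˡ-≤ (4 * y * D) (*-monoʳ-≤ t h) ⟩
      t * (4 * y * P + D) + 4 * y * D            ≤⟨ +-monoˡ-≤ (4 * y * D) (m≤m+n _ D) ⟩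
      t * (4 * y * P + D) + D + 4 * y * D        ≡⟨ l₂ t y D P ⟩
      4 * y * (t * P) + (suc t * D + 4 * y * D)  ≡⟨ cong (λ z → 4 * y * (t * P) + (z * D + 4 * y * D)) (sym e) ⟩
      4 * y * (t * P) + (2 * y * D + 4 * y * D)  ≡⟨ l₃ t y D P ⟩
      4 * y * (t * P) + 3 * (2 * y * D)          ∎
      where
      open ≤-Reasoning
      l₁ : ∀ t y D → 4 * y * (suc t * D) ≡ t * (4 * y * D) + 4 * y * D
      l₁ = solve-∀
      l₂ : ∀ t y D P → t * (4 * y * P + D) + D + 4 * y * D ≡ 4 * y * (t * P) + (suc t * D + 4 * y * D)
      l₂ = solve-∀
      l₃ : ∀ t y D P → 4 * y * (t * P) + (2 * y * D + 4 * y * D) ≡ 4 * y * (t * P) + 3 * (2 * y * D)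
      l₃ = solve-∀
    by-cases : 4 * q ^ r * product (map double bs) ≤ 4 * q ^ r * product (map double-1 bs) + 3 * product (map double bs)
    by-cases with r ∈? bs
    ... | yes r∈ = let cs , perm , u′ = remove r∈ u in
      subst₂ (λ D P → 4 * y * D ≤ 4 * y * P + 3 * D) (sym (product-map-↭ double perm)) (sym (product-map-↭ double-1 perm))
        (step (double-1 r) y (product (map double cs)) (product (map double-1 cs))
          (sym (m+[n∸m]≡n {1} (*-mono-≤ {1} {2} {1} (s≤s z≤n) (>-nonZero⁻¹ y {{m^n≢0 q r {{>-nonZero (≤-trans (s≤s z≤n) 3≤q)}}}}))))
          (tighten _ _ (power-product-range k (suc r) cs (AllPairs.tail u′) (remove-bound perm u′ b))))
    ... | no r∉ = ≤-trans (tighten _ _ (power-product-range k (suc r) bs u (keep-bound r∉ b)))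
                   (+-monoʳ-≤ (4 * y * product (map double-1 bs)) (m≤n*m (product (map double bs)) 3))

  power-product : ∀ bs → Unique bs → All (1 ≤_) bs →
    4 * q * product (map double bs) ≤ 4 * q * product (map double-1 bs) + 3 * product (map double bs)
  power-product bs u b = subst (λ y → 4 * y * product (map double bs) ≤ 4 * y * product (map double-1 bs) + 3 * product (map double bs))
    (*-identityʳ q) (power-product-range (suc (max bs)) 1 bs u (in-range b))

-- The equation σ∞ (σ∞ N) = 2 N

prime[3] : Prime 3
prime[3] = from-yes (prime? 3)

prime[5] : Prime 5
prime[5] = from-yes (prime? 5)

prime≢1 : ∀ {p} → Prime p → p ≢ 1
prime≢1 pr refl = ¬prime[1] pr

∣1-prime : ∀ {p} → Prime p → ¬ p ∣ 1
∣1-prime pr h = prime≢1 pr (∣1⇒≡1 h)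

product-mono : ∀ {f g : ℕ → ℕ} → (∀ i → f i ≤ g i) → ∀ xs → product (map f xs) ≤ product (map g xs)
product-mono h [] = ≤-refl
product-mono h (x ∷ xs) = *-mono-≤ (h x) (product-mono h xs)

product≤product-suc : ∀ xs → product xs ≤ product (map suc xs)
product≤product-suc [] = ≤-refl
product≤product-suc (x ∷ xs) = *-mono-≤ (n≤1+n x) (product≤product-suc xs)

product-E : ∀ I → ∃ λ f → product (map E I) ≡ 2 ^ f
product-E [] = 0 , refl
product-E (i ∷ I) with f , e ← product-E I = 2 ^ i + f , trans (cong (E i *_) e) (sym (^-distribˡ-+-* 2 (2 ^ i) f))

prime∣product : ∀ {p} → Prime p → ∀ xs → p ∣ product xs → ∃ λ x → x ∈ xs × p ∣ x
prime∣product pr [] h = contradiction h (∣1-prime pr)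
prime∣product pr (x ∷ xs) h with euclidsLemma x (product xs) pr h
... | inj₁ p∣x = x , here refl , p∣x
... | inj₂ p∣xs with y , y∈ , p∣y ← prime∣product pr xs p∣xs = y , there y∈ , p∣y

component-of-prime : ∀ {p P} → Prime p → Component P → p ∣ P → ∃ λ j → P ≡ p ^ (2 ^ j)
component-of-prime pr (q , j , qr , refl) h with refl ← prime∣prime pr qr (prime∣^ q (2 ^ j) pr h) = j , refl

2≤component : ∀ {P} → Component P → 2 ≤ P
2≤component (p , j , pr , refl) with 2 ^ j | 2^≢0 j
... | zero | h = contradiction refl h
... | suc k | _ = ≤-trans (prime⇒2≤ pr) (m≤m*n p (p ^ k) {{m^n≢0 p k {{prime⇒nonZero pr}}}})

even-components : ∀ {Rs} → All Component Rs → All (2 ∣_) Rs → ∃ λ I → Rs ≡ map E I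
even-components [] [] = [] , refl
even-components (c ∷ cs) (2∣R ∷ evens) with j , refl ← component-of-prime prime[2] c 2∣R | I , refl ← even-components cs evens = j ∷ I , refl

odd-product : ∀ {xs} → All Odd xs → Odd (product xs)
odd-product [] = from-no (2 ∣? 1)
odd-product (o ∷ os) = odd-* o (odd-product os)

odd-suc : ∀ {n} → 2 ∣ n → Odd (suc n)
odd-suc {n} h h′ = from-no (2 ∣? 1) (∣m+n∣m⇒∣n (subst (2 ∣_) (+-comm 1 n) h′) h)

All-map-suc : ∀ {xs} → All (2 ∣_) xs → All Odd (map suc xs)
All-map-suc [] = []
All-map-suc (h ∷ hs) = odd-suc h ∷ All-map-suc hs

record OneOdd (Ms : List ℕ) : Set where
  field
    Q : ℕ
    I : List ℕ
    compQ : Component Q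
    oddQ : Odd Q
    uI : Unique I
    perm : Ms ↭ Q ∷ map E I

-- An odd component contributes an even factor to 2 N and an even one an odd factor. As N is odd,
-- there is exactly one odd component.
one-odd : ∀ {Ms N} → All Component Ms → Unique Ms → Odd N → product (map suc Ms) ≡ 2 * N → OneOdd Ms
one-odd {Ms} {N} cs u oddN e with any? (λ P → ¬? (2 ∣? P)) Ms
... | no none = contradiction (subst (2 ∣_) (sym e) (m∣m*n N))
      (odd-product (All-map-suc (All.map (λ {P} h → decidable-stable (2 ∣? P) h) (¬Any⇒All¬ Ms none))))
... | yes some with Q , Q∈ , oddQ ← find some with Rs , perm , u′ ← remove Q∈ u with cQ ∷ cRs ← All-resp-↭ perm cs
  with any? (λ P → ¬? (2 ∣? P)) Rs
...   | yes some′ with R , R∈ , oddR ← find some′ with Ss , perm′ , _ ← remove R∈ (AllPairs.tail u′) =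
        contradiction (*-cancelˡ-∣ 2 (subst (4 ∣_) e′ (*-pres-∣ (odd⇒2∣suc oddQ) (∣m⇒∣m*n (product (map suc Ss)) (odd⇒2∣suc oddR))))) oddN
  where
  e′ : suc Q * (suc R * product (map suc Ss)) ≡ 2 * N
  e′ = trans (cong (suc Q *_) (sym (product-map-↭ suc perm′))) (trans (sym (product-map-↭ suc perm)) e)
...   | no none with I , refl ← even-components cRs (All.map (λ {P} h → decidable-stable (2 ∣? P) h) (¬Any⇒All¬ Rs none)) =
        record { Q = Q ; I = I ; compQ = cQ ; oddQ = oddQ ; uI = Unique.map⁻ (AllPairs.tail u′) ; perm = perm }

-- Residues modulo 3 and 5

∤⇒square-mod3 : ∀ x → ¬ 3 ∣ x → (x * x) % 3 ≡ 1
∤⇒square-mod3 x 3∤x with x % 3 in e | m%n<n x 3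
... | 0 | _ = contradiction (m%n≡0⇒n∣m x 3 e) 3∤x
... | 1 | _ = mod-* 3 x x e e
... | 2 | _ = mod-* 3 x x e e
... | suc (suc (suc _)) | s≤s (s≤s (s≤s ()))

-- The two alternatives are even and odd exponents. Keeping residue and shape together lets the
-- residue 1 identify the power as a square.
mod3≡2-^ : ∀ q → q % 3 ≡ 2 → ∀ c → (∃ λ s → q ^ c ≡ s * s × q ^ c % 3 ≡ 1) ⊎ (∃ λ s → q ^ c ≡ q * (s * s) × q ^ c % 3 ≡ 2)
mod3≡2-^ q e zero = inj₁ (1 , refl , refl)
mod3≡2-^ q e (suc c) with mod3≡2-^ q e c
... | inj₁ (s , r , m) = inj₂ (s , cong (q *_) r , mod-* 3 q (q ^ c) e m)
... | inj₂ (s , r , m) = inj₁ (q * s , trans (cong (q *_) r) (lem q s) , mod-* 3 q (q ^ c) e m)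
  where
  lem : ∀ q s → q * (q * (s * s)) ≡ q * s * (q * s)
  lem = solve-∀

mod3≡1-^ : ∀ q → q % 3 ≡ 1 → ∀ c → q ^ c % 3 ≡ 1
mod3≡1-^ q e zero = refl
mod3≡1-^ q e (suc c) = mod-* 3 q (q ^ c) e (mod3≡1-^ q e c)

-- Modulo 3 the equation reads 2 q^b ≡ 1, which fails when q ≡ 0 or q ≡ 1.
base-from-3 : ∀ {q k b} → suc (3 ^ (2 ^ k)) ≡ 2 * q ^ b → q % 3 ≡ 2
base-from-3 {q} {k} {b} e with q % 3 in m | m%n<n q 3 | trans (sym (cong (_% 3) e)) (mod-suc 3 (3 ^ (2 ^ k)) (n∣m⇒m%n≡0 _ 3 (∣^≢0 3 (2 ^ k) (2^≢0 k))))
... | 2 | _ | _ = refl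
... | 1 | _ | h with () ← trans (sym (mod-* 3 2 (q ^ b) refl (mod3≡1-^ q m b))) h
... | 0 | _ | h with b
...   | zero with () ← h
...   | suc b′ with () ← trans (sym (mod-* 3 2 (q * q ^ b′) refl (mod-* 3 q (q ^ b′) m refl))) h
base-from-3 {q} {k} {b} e | suc (suc (suc _)) | s≤s (s≤s (s≤s ())) | _

-- Squares are 0, 1 or 4 modulo 5, so their doubles are 0, 2 or 3.
twice-square-mod5 : ∀ s → (2 * (s * s)) % 5 ≢ 1
twice-square-mod5 s h with s % 5 in m | m%n<n s 5
... | 0 | _ with () ← trans (sym h) (mod-* 5 2 (s * s) refl (mod-* 5 s s m m))
... | 1 | _ with () ← trans (sym h) (mod-* 5 2 (s * s) refl (mod-* 5 s s m m))
... | 2 | _ with () ← trans (sym h) (mod-* 5 2 (s * s) refl (mod-* 5 s s m m))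
... | 3 | _ with () ← trans (sym h) (mod-* 5 2 (s * s) refl (mod-* 5 s s m m))
... | 4 | _ with () ← trans (sym h) (mod-* 5 2 (s * s) refl (mod-* 5 s s m m))
... | suc (suc (suc (suc (suc _)))) | s≤s (s≤s (s≤s (s≤s (s≤s ()))))

-- For j ≥ 1 the power q^c is ≡ 1 (mod 3), hence a square, but it is ≡ 3 (mod 5).
no-base-from-5 : ∀ {q j c} → q % 3 ≡ 2 → suc (5 ^ (2 ^ j)) ≢ 2 * q ^ c
-- For `j` = 0 the equation says q^c = 3, while q^c is 1 or 2 modulo 3.
no-base-from-5 {q} {zero} {c} m e with mod3≡2-^ q m c
... | inj₁ (_ , _ , h) with () ← trans (sym h) (cong (_% 3) (sym (*-cancelˡ-≡ 3 (q ^ c) 2 e)))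
... | inj₂ (_ , _ , h) with () ← trans (sym h) (cong (_% 3) (sym (*-cancelˡ-≡ 3 (q ^ c) 2 e)))
no-base-from-5 {q} {suc j} {c} m e with mod3≡2-^ q m c
... | inj₂ (_ , _ , h) with () ← trans (sym (mod-* 3 2 (q ^ c) refl h)) (trans (sym (cong (_% 3) e)) (mod-suc 3 (5 ^ (2 ^ suc j))
        (trans (cong (_% 3) (^-2^suc 5 j)) (∤⇒square-mod3 (5 ^ (2 ^ j)) λ d → from-no (3 ∣? 5) (prime∣^ 5 (2 ^ j) prime[3] d)))))
... | inj₁ (s , sq , _) = twice-square-mod5 s (trans (cong (λ z → (2 * z) % 5) (sym sq)) (trans (sym (cong (_% 5) e))
        (mod-suc 5 (5 ^ (2 ^ suc j)) (n∣m⇒m%n≡0 _ 5 (∣^≢0 5 (2 ^ suc j) (2^≢0 (suc j)))))))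

NotTwoMod3 : ℕ → Set
NotTwoMod3 n = n % 3 ≡ 0 ⊎ n % 3 ≡ 1

-- The residue 2 would make 3 divide a power of 2.
mersenne-mod3 : ∀ {P a} → suc P ≡ 2 ^ a → NotTwoMod3 P
mersenne-mod3 {P} {a} e with P % 3 in m | m%n<n P 3
... | 0 | _ = inj₁ refl
... | 1 | _ = inj₂ refl
... | 2 | _ = contradiction (prime∣^ 2 a prime[3] (subst (3 ∣_) e (m%n≡0⇒n∣m (suc P) 3 (mod-suc 3 P m)))) (from-no (3 ∣? 2))
... | suc (suc (suc _)) | s≤s (s≤s (s≤s ()))

product-NotTwoMod3 : ∀ {xs} → All NotTwoMod3 xs → NotTwoMod3 (product xs)
product-NotTwoMod3 [] = inj₂ refl
product-NotTwoMod3 {x ∷ xs} (h ∷ hs) with h | product-NotTwoMod3 hs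
... | inj₁ a | _ = inj₁ (mod-* 3 x (product xs) a refl)
... | inj₂ a | inj₁ b = inj₁ (mod-* 3 x (product xs) a b)
... | inj₂ a | inj₂ b = inj₂ (mod-* 3 x (product xs) a b)

-- Since P = 2q - 1 is prime to 3, the residues of (P, q) are (1, 1) or (2, 0); in both cases the
-- equation would give M ≡ 2.
mod3-clash : ∀ {q P X M} → suc P ≡ 2 * q → P % 3 ≢ 0 → X % 3 ≡ 2 → NotTwoMod3 M → suc q * X ≢ 2 * (P * M)
mod3-clash {q} {P} {X} {M} e 3∤P x m eq with P % 3 in p | m%n<n P 3 | q % 3 in k | m%n<n q 3
... | 0 | _ | _ | _ = 3∤P refl
... | 1 | _ | 0 | _ with () ← trans (sym (mod-suc 3 P p)) (trans (cong (_% 3) e) (mod-* 3 2 q refl k))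
... | 1 | _ | 2 | _ with () ← trans (sym (mod-suc 3 P p)) (trans (cong (_% 3) e) (mod-* 3 2 q refl k))
... | 2 | _ | 1 | _ with () ← trans (sym (mod-suc 3 P p)) (trans (cong (_% 3) e) (mod-* 3 2 q refl k))
... | 2 | _ | 2 | _ with () ← trans (sym (mod-suc 3 P p)) (trans (cong (_% 3) e) (mod-* 3 2 q refl k))
... | 1 | _ | 1 | _ = excluded m
  where
  sides : ∀ {c} → M % 3 ≡ c → 1 ≡ (2 * c) % 3
  sides {c} h = trans (sym (mod-* 3 (suc q) X (mod-suc 3 q k) x)) (trans (cong (_% 3) eq) (mod-* 3 2 (P * M) refl (trans (mod-* 3 P M p refl) (trans (cong (_% 3) (*-identityˡ (M % 3))) (trans (m%n%n≡m%n M 3) h)))))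
  excluded : ¬ NotTwoMod3 M
  excluded (inj₁ h) with () ← sides h
  excluded (inj₂ h) with () ← sides h
... | 2 | _ | 0 | _ = excluded m
  where
  sides : ∀ {c} → M % 3 ≡ c → 2 ≡ (2 * ((2 * c) % 3)) % 3
  sides {c} h = trans (sym (mod-* 3 (suc q) X (mod-suc 3 q k) x)) (trans (cong (_% 3) eq) (mod-* 3 2 (P * M) refl (mod-* 3 P M p h)))
  excluded : ¬ NotTwoMod3 M
  excluded (inj₁ h) with () ← sides h
  excluded (inj₂ h) with () ← sides h
... | suc (suc (suc _)) | s≤s (s≤s (s≤s ())) | _ | _
... | 1 | _ | suc (suc (suc _)) | s≤s (s≤s (s≤s ()))
... | 2 | _ | suc (suc (suc _)) | s≤s (s≤s (s≤s ()))

-- With denominators cleared, the hypotheses are N/(Q G) ≥ α/β and F/G ≤ δ/γ. Inserted into (1 + Q)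
-- F = 2 N, they bound Q/(1 + Q) by βδ/(2αγ), which a large Q violates once this ratio is below 1.
combine-bounds : ∀ {α β γ δ Q F G N} → 0 < G → α * (Q * G) ≤ β * N → suc Q * F ≡ 2 * N → γ * F ≤ δ * G → 2 * α * γ * Q ≤ β * δ * suc Q
combine-bounds {α} {β} {γ} {δ} {Q} {F} {G} {N} 0<G h₁ e h₂ = *-cancelʳ-≤ _ _ G {{>-nonZero 0<G}} (begin
  2 * α * γ * Q * G          ≡⟨ l₁ α γ Q G ⟩
  2 * γ * (α * (Q * G))      ≤⟨ *-monoʳ-≤ (2 * γ) h₁ ⟩
  2 * γ * (β * N)            ≡⟨ l₂ β γ N ⟩
  β * γ * (2 * N)            ≡⟨ cong (β * γ *_) (sym e) ⟩
  β * γ * (suc Q * F)        ≡⟨ l₃ β γ (suc Q) F ⟩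
  β * suc Q * (γ * F)        ≤⟨ *-monoʳ-≤ (β * suc Q) h₂ ⟩
  β * suc Q * (δ * G)        ≡⟨ l₄ β δ (suc Q) G ⟩
  β * δ * suc Q * G          ∎)
  where
  open ≤-Reasoning
  l₁ : ∀ α γ Q G → 2 * α * γ * Q * G ≡ 2 * γ * (α * (Q * G))
  l₁ = solve-∀
  l₂ : ∀ β γ N → 2 * γ * (β * N) ≡ β * γ * (2 * N)
  l₂ = solve-∀
  l₃ : ∀ β γ R F → β * γ * (R * F) ≡ β * R * (γ * F)
  l₃ = solve-∀
  l₄ : ∀ β δ R G → β * R * (δ * G) ≡ β * δ * R * G
  l₄ = solve-∀

-- In terms of components, `eq₁` is σ∞ N = Q G and `eq₂` is σ∞ (Q G) = 2 N.
module Core {N : ℕ} (oddN : Odd N) {Ps : List ℕ} (comps : All Component Ps) (uPs : Unique Ps) (N≡ : N ≡ product Ps)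
            {q l : ℕ} (qpr : Prime q) (oddq : Odd q) {I : List ℕ} (uI : Unique I)
            (eq₁ : product (map suc Ps) ≡ q ^ (2 ^ l) * product (map E I))
            (eq₂ : suc (q ^ (2 ^ l)) * product (map fermat I) ≡ 2 * N) where
  Q G F : ℕ
  Q = q ^ (2 ^ l)
  G = product (map E I)
  F = product (map fermat I)

  0<G : 0 < G
  0<G with f , e ← product-E I = subst (0 <_) (sym e) (0<^ prime[2] f)

  3≤q : 3 ≤ q
  3≤q = ≤∧≢⇒< (prime⇒2≤ qpr) λ { refl → oddq ∣-refl }

  ∈⇒∣N : ∀ {P} → P ∈ Ps → P ∣ N
  ∈⇒∣N P∈ = subst (_ ∣_) (sym N≡) (∈⇒∣product P∈)

  odd-part : ∀ {P} → P ∈ Ps → Odd P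
  odd-part P∈ = odd-∣ (∈⇒∣N P∈) oddN

  odd∣2N⇒∣N : ∀ {p} → Prime p → Odd p → p ∣ 2 * N → p ∣ N
  odd∣2N⇒∣N pr op h with euclidsLemma 2 N pr h
  ... | inj₁ p∣2 = contradiction (∣-reflexive (sym (prime∣prime pr prime[2] p∣2))) op
  ... | inj₂ p∣N = p∣N

  part-of-prime : ∀ {p} → Prime p → p ∣ N → ∃ λ j → p ^ (2 ^ j) ∈ Ps
  part-of-prime pr h with P , P∈ , p∣P ← prime∣product pr Ps (subst (_ ∣_) N≡ h)
    with j , refl ← component-of-prime pr (All.lookup comps P∈) p∣P = j , P∈

  index-∣2N : ∀ {i p} → i ∈ I → p ∣ suc (E i) → p ∣ 2 * N
  index-∣2N {p = p} i∈ h = subst (p ∣_) eq₂ (∣n⇒∣m*n (suc Q) (∣-trans h (∈⇒∣product (∈-map⁺ fermat i∈))))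

  part-of-index : ∀ {i p} → Prime p → i ∈ I → p ∣ suc (E i) → ∃ λ j → p ^ (2 ^ j) ∈ Ps
  part-of-index {i} pr i∈ h = part-of-prime pr (odd∣2N⇒∣N pr (odd-∣ h (odd-fermat i)) (index-∣2N i∈ h))

  -- Otherwise σ∞(N)/N ≥ 4/3 and σ∞(M)/M > 3/2 for M = σ∞(N), so that σ∞(M) > 2N.
  0∈I⇒3∉Ps : 0 ∈ I → ¬ 3 ∈ Ps
  0∈I⇒3∉Ps 0∈ 3∈ with J , permI , _ ← remove 0∈ uI | Ps′ , permP , _ ← remove 3∈ uPs = <⇒≱ T<N N≤T
    where
    N′ = product Ps′
    T′ = product (map suc Ps′)
    F′ = product (map fermat J)
    G′ = product (map E J)
    2T≡ : 2 * T′ ≡ Q * G′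
    2T≡ = *-cancelˡ-≡ (2 * T′) (Q * G′) 2 (trans (l₁ T′) (trans (sym (product-map-↭ suc permP)) (trans eq₁ (trans (cong (Q *_) (product-map-↭ E permI)) (l₂ Q G′)))))
      where
      l₁ : ∀ T → 2 * (2 * T) ≡ 4 * T
      l₁ = solve-∀
      l₂ : ∀ Q G → Q * (2 * G) ≡ 2 * (Q * G)
      l₂ = solve-∀
    2N≡ : 2 * N′ ≡ suc Q * F′
    2N≡ = *-cancelˡ-≡ (2 * N′) (suc Q * F′) 3 (trans (l₁ N′) (trans (cong (2 *_) (sym (trans N≡ (product-↭ permP)))) (trans (sym eq₂) (trans (cong (suc Q *_) (product-map-↭ fermat permI)) (l₂ (suc Q) F′)))))
      where
      l₁ : ∀ T → 3 * (2 * T) ≡ 2 * (3 * T)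
      l₁ = solve-∀
      l₂ : ∀ Q G → Q * (3 * G) ≡ 3 * (Q * G)
      l₂ = solve-∀
    0<G′ : 0 < G′
    0<G′ with f , e ← product-E J = subst (0 <_) (sym e) (0<^ prime[2] f)
    T<N : 2 * T′ < 2 * N′
    T<N = subst₂ _<_ (sym 2T≡) (sym 2N≡) (<-≤-trans (m<n+m (Q * G′) 0<G′) (*-monoʳ-≤ (suc Q) (product-mono (λ i → n≤1+n (E i)) J)))
    N≤T : 2 * N′ ≤ 2 * T′
    N≤T = *-monoʳ-≤ 2 (product≤product-suc Ps′)

  square-part-mod4 : ∀ {p j} → p ^ (2 ^ suc j) ∈ Ps → p ^ (2 ^ suc j) % 4 ≡ 1
  square-part-mod4 {p} {j} P∈ = trans (cong (_% 4) (^-2^suc p j)) (odd-square-mod4 {p ^ (2 ^ j)} λ h → odd-part P∈ (subst (2 ∣_) (sym (^-2^suc p j)) (∣m⇒∣m*n (p ^ (2 ^ j)) h)))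

  -- For `i` ≥ 1 already `p` ≡ 1 (mod 4). For `i` = 0 the prime is 3, and its component is not 3
  -- itself, hence an odd square.
  index-part-mod4 : ∀ {i p j} → Prime p → i ∈ I → p ∣ suc (E i) → p ^ (2 ^ j) ∈ Ps → p ^ (2 ^ j) % 4 ≡ 1
  index-part-mod4 {suc i} {p} {j} pr i∈ h P∈ = mod4≡1-^ p (2 ^ j) (fermat-mod4 {i = suc i} (s≤s z≤n) h)
  index-part-mod4 {zero} {p} {j} pr 0∈ h P∈ with refl ← prime∣prime pr prime[3] h | j
  ... | zero = contradiction P∈ (0∈I⇒3∉Ps 0∈)
  ... | suc j = square-part-mod4 {j = j} P∈

  suc-part-∣ : ∀ {P} → P ∈ Ps → suc P ∣ Q * G
  suc-part-∣ P∈ = subst (_ ∣_) eq₁ (∈⇒∣product (∈-map⁺ suc P∈))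

  -- Here 1 + P = 2 s with s odd. As s divides Q G and G is a power of 2, s divides Q and is a power
  -- of q; it is not 1, because P ≥ 2.
  mod4⇒twice-power : ∀ {P} → P ∈ Ps → P % 4 ≡ 1 → ∃ λ b → suc P ≡ 2 * q ^ suc b
  mod4⇒twice-power {P} P∈ e with odd⇒2∣suc (odd-part P∈) | product-E I
  ... | divides s sP | f , G≡ = positive (proj₁ s-power) (trans sP (trans (cong (_* 2) (proj₂ s-power)) (*-comm (q ^ proj₁ s-power) 2)))
    where
    odd-s : Odd s
    odd-s 2∣s = from-no (4 ∣? 2) (m%n≡0⇒n∣m 2 4 (trans (sym (mod-suc 4 P e)) (n∣m⇒m%n≡0 (suc P) 4 (subst (4 ∣_) (sym sP) (*-pres-∣ 2∣s (∣-refl {2}))))))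
    s∣Q : s ∣ Q
    s∣Q = ∤⇒∣-cancel-^ prime[2] odd-s f (subst (s ∣_) (trans (*-comm Q G) (cong (_* Q) G≡)) (∣-trans (divides 2 (trans sP (*-comm s 2))) (suc-part-∣ P∈)))
    s-power : ∃ λ b → s ≡ q ^ b
    s-power = ∣p^n qpr (2 ^ l) s∣Q
    positive : ∀ b → suc P ≡ 2 * q ^ b → ∃ λ b → suc P ≡ 2 * q ^ suc b
    positive (suc b) e = b , e
    positive zero e = contradiction (subst (2 ≤_) (suc-injective e) (2≤component (All.lookup comps P∈))) λ { (s≤s ()) }

  twice-powers : All (λ P → P % 4 ≡ 1) Ps → ∃ λ bs → Ps ≡ map (double-1 q 3≤q) bs × map suc Ps ≡ map (double q 3≤q) bs × All (1 ≤_) bs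
  twice-powers all≡1 = go (All.tabulate λ P∈ → mod4⇒twice-power P∈ (All.lookup all≡1 P∈))
    where
    go : ∀ {Rs} → All (λ P → ∃ λ b → suc P ≡ 2 * q ^ suc b) Rs →
         ∃ λ bs → Rs ≡ map (double-1 q 3≤q) bs × map suc Rs ≡ map (double q 3≤q) bs × All (1 ≤_) bs
    go [] = [] , refl , refl , []
    go ((b , e) ∷ hs) with bs , e₁ , e₂ , pos ← go hs = suc b ∷ bs , cong₂ _∷_ (cong (_∸ 1) e) e₁ , cong₂ _∷_ e e₂ , s≤s z≤n ∷ pos

  -- This is N/σ∞(N) ≥ 1 - 3/(4q): the components are 2 q^b - 1, and the exponents b are distinct
  -- because the components are.
  parts-bound : All (λ P → P % 4 ≡ 1) Ps → 4 * q * (Q * G) ≤ 4 * q * N + 3 * (Q * G)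
  parts-bound all≡1 with bs , e₁ , e₂ , pos ← twice-powers all≡1 =
    subst₂ (λ D P → 4 * q * D ≤ 4 * q * P + 3 * D) (trans (cong product (sym e₂)) eq₁) (trans (cong product (sym e₁)) (sym N≡))
      (power-product q 3≤q bs (Unique.map⁻ (subst Unique e₁ uPs)) pos)

  module _ {l′ : ℕ} (l≡ : l ≡ suc l′) where
    r : ℕ
    r = q ^ (2 ^ l′)

    Q≡r² : Q ≡ r * r
    Q≡r² = trans (cong (λ l → q ^ (2 ^ l)) l≡) (^-2^suc q l′)

    q≤r : q ≤ r
    q≤r = ∣⇒≤ {{m^n≢0 q (2 ^ l′) {{prime⇒nonZero qpr}}}} (∣^≢0 q (2 ^ l′) (2^≢0 l′))

    -- A component with `j` ≥ 1 is an odd square. A prime one divides 1 + Q = r² + 1 or one of the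
    -- Fermat numbers in F, and both force the residue 1.
    parts-mod4 : All (λ P → P % 4 ≡ 1) Ps
    parts-mod4 = All.tabulate λ {P} P∈ → go P∈ (All.lookup comps P∈)
      where
      go : ∀ {P} → P ∈ Ps → Component P → P % 4 ≡ 1
      go P∈ (p , suc j , pr , refl) = square-part-mod4 {j = j} P∈
      go {P} P∈ (p , zero , pr , refl) with p∣N ← subst (_∣ N) (*-identityʳ p) (∈⇒∣N P∈)
        with euclidsLemma (suc Q) F pr (subst (p ∣_) (sym eq₂) (∣n⇒∣m*n 2 p∣N))
      ... | inj₁ p∣sucQ = trans (cong (_% 4) (*-identityʳ p)) (odd∣x²+1⇒mod4≡1 r (odd-∣ p∣N oddN) (subst (λ z → p ∣ suc z) Q≡r² p∣sucQ))
      ... | inj₂ p∣F with x , x∈ , p∣x ← prime∣product pr (map fermat I) p∣F with i , i∈ , refl ← ∈-map⁻ fermat x∈ = index-part-mod4 {j = 0} pr i∈ p∣x P∈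

    twice-power : ∀ {P} → P ∈ Ps → ∃ λ b → suc P ≡ 2 * q ^ suc b
    twice-power P∈ = mod4⇒twice-power P∈ (All.lookup parts-mod4 P∈)

    0∈I⇒q-mod3 : 0 ∈ I → q % 3 ≡ 2
    0∈I⇒q-mod3 0∈ with k , P∈ ← part-of-index prime[3] 0∈ ∣-refl with b , e ← twice-power P∈ = base-from-3 {q} {k = k} {suc b} e

    -- The Fermat numbers of index 0 and 1 are the primes 3 and 5; the component of 3 forces q ≡ 2
    -- (mod 3), which rules out that of 5.
    ¬0∈I×1∈I : 0 ∈ I → ¬ 1 ∈ I
    ¬0∈I×1∈I 0∈ 1∈ with j , P∈ ← part-of-index prime[5] 1∈ ∣-refl with b , e ← twice-power P∈ = no-base-from-5 {q} {j} {suc b} (0∈I⇒q-mod3 0∈) e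

    square-exponent-impossible : ⊥
    square-exponent-impossible with 0 ∈? I
    -- From q ≥ 3 comes N/(Q G) ≥ 3/4, and indices from 1 on give F/G ≤ 4/3. Together 18 Q ≤ 16 (Q +
    -- 1), against Q ≥ 9.
    ... | no 0∉ = <⇒≱ too-big (combine-bounds {3} {4} {3} {4} {Q} {F} {G} {N} 0<G
            (+-cancelˡ-≤ (Q * G) _ _ (subst (4 * (Q * G) ≤_) (+-comm (4 * N) (Q * G))
              (scale-≤ {4} {4 * q} {Q * G} {N} {3} {Q * G} (*-monoʳ-≤ 4 3≤q) (parts-bound parts-mod4))))
            eq₂ (+-cancelˡ-≤ F _ _ (fermat-product 1 I uI (All.tabulate λ { {zero} i∈ → contradiction i∈ 0∉ ; {suc _} _ → s≤s z≤n }))))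
      where
      9≤Q : 9 ≤ Q
      9≤Q = subst (9 ≤_) (sym Q≡r²) (*-mono-≤ (≤-trans 3≤q q≤r) (≤-trans 3≤q q≤r))
      too-big : 16 * suc Q < 18 * Q
      too-big = subst₂ _≤_ (lem₁ Q) (lem₂ Q) (+-monoʳ-≤ (16 * Q) (≤-trans (from-yes (17 ≤? 18)) (*-monoʳ-≤ 2 9≤Q)))
        where
        lem₁ : ∀ Q → 16 * Q + 17 ≡ suc (16 * suc Q)
        lem₁ = solve-∀
        lem₂ : ∀ Q → 16 * Q + 2 * Q ≡ 18 * Q
        lem₂ = solve-∀
    -- Now q ≥ 5 gives N/(Q G) ≥ 1 - 3/20 = 17/20. As 1 is not in `I`, F/G ≤ 3/2 · 16/15 = 8/5.
    -- Together 170 Q ≤ 160 (Q + 1), against Q ≥ 25.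
    ... | yes 0∈ with J , perm , u′ ← remove 0∈ uI = <⇒≱ too-big (combine-bounds {17} {20} {5} {8} {Q} {F} {G} {N} 0<G
            (+-cancelˡ-≤ (3 * (Q * G)) _ _ (subst₂ _≤_ (lem₁ (Q * G)) (+-comm (20 * N) (3 * (Q * G)))
              (scale-≤ {20} {4 * q} {Q * G} {N} {1} {3 * (Q * G)} (*-monoʳ-≤ 4 5≤q) (subst (λ z → 4 * q * (Q * G) ≤ 4 * q * N + z) (sym (*-identityˡ (3 * (Q * G)))) (parts-bound parts-mod4)))))
            eq₂ (subst₂ (λ F G → 5 * F ≤ 8 * G) (sym (product-map-↭ fermat perm)) (sym (product-map-↭ E perm))
              (subst₂ _≤_ (lem₂ F′) (lem₃ G′) (+-cancelˡ-≤ F′ _ _ (fermat-product 2 J (AllPairs.tail u′) 2≤J)))))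
      where
      F′ = product (map fermat J)
      G′ = product (map E J)
      lem₁ : ∀ T → 20 * T ≡ 3 * T + 17 * T
      lem₁ = solve-∀
      lem₂ : ∀ F → 15 * F ≡ 5 * (3 * F)
      lem₂ = solve-∀
      lem₃ : ∀ G → 16 * G ≡ 8 * (2 * G)
      lem₃ = solve-∀
      2≤J : All (2 ≤_) J
      2≤J = All.tabulate 2≤
        where
        2≤ : ∀ {i} → i ∈ J → 2 ≤ i
        2≤ {zero} i∈ = contradiction refl (All.lookup (AllPairs.head u′) i∈)
        2≤ {suc zero} i∈ = contradiction (∈-resp-↭ (↭-sym perm) (there i∈)) (¬0∈I×1∈I 0∈)
        2≤ {suc (suc _)} _ = s≤s (s≤s z≤n)
      5≤q : 5 ≤ q
      5≤q = lem q 3≤q oddq (0∈I⇒q-mod3 0∈)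
        where
        lem : ∀ q → 3 ≤ q → Odd q → q % 3 ≡ 2 → 5 ≤ q
        lem (suc (suc (suc (suc (suc q))))) _ _ _ = s≤s (s≤s (s≤s (s≤s (s≤s z≤n))))
        lem 1 (s≤s ()) _ _
        lem 2 (s≤s (s≤s ())) _ _
      25≤Q : 25 ≤ Q
      25≤Q = subst (25 ≤_) (sym Q≡r²) (*-mono-≤ (≤-trans 5≤q q≤r) (≤-trans 5≤q q≤r))
      too-big : 160 * suc Q < 170 * Q
      too-big = subst₂ _≤_ (l₁ Q) (l₂ Q) (+-monoʳ-≤ (160 * Q) (≤-trans (from-yes (161 ≤? 250)) (*-monoʳ-≤ 10 25≤Q)))
        where
        l₁ : ∀ Q → 160 * Q + 161 ≡ suc (160 * suc Q)
        l₁ = solve-∀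
        l₂ : ∀ Q → 160 * Q + 10 * Q ≡ 170 * Q
        l₂ = solve-∀

  module _ (l≡0 : l ≡ 0) where
    Q≡q : Q ≡ q
    Q≡q = trans (cong (λ l → q ^ (2 ^ l)) l≡0) (*-identityʳ q)

    -- σ∞(N) contains only one factor q, which the component of a prime dividing the
    -- Fermat number suc (E i) uses up; the remaining components are 2^a - 1.
    module _ {i p j : ℕ} (i∈ : i ∈ I) (1≤i : 1 ≤ i) (pr : Prime p) (p∣ : p ∣ suc (E i)) (P∈ : p ^ (2 ^ j) ∈ Ps) where
      P : ℕ
      P = p ^ (2 ^ j)

      P-mod4 : P % 4 ≡ 1
      P-mod4 = index-part-mod4 {j = j} pr i∈ p∣ P∈

      p-mod4 : p % 4 ≡ 1
      p-mod4 = fermat-mod4 {i = i} 1≤i p∣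

      module _ {Ps′ : List ℕ} (perm : Ps ↭ P ∷ Ps′) where
        T′ = product (map suc Ps′)

        split : suc P ≡ 2 * q × 2 * T′ ≡ G
        split with b , e ← mod4⇒twice-power P∈ P-mod4 = by-cases b e
          where
          cancelled : ∀ b → suc P ≡ 2 * q ^ suc b → q ^ b * (2 * T′) ≡ G
          cancelled b e = *-cancelˡ-≡ _ _ q {{prime⇒nonZero qpr}} (trans (lem q (q ^ b) T′) (trans (cong (_* T′) (sym e))
             (trans (sym (product-map-↭ suc perm)) (trans eq₁ (cong (_* G) Q≡q)))))
            where
            lem : ∀ q x T → q * (x * (2 * T)) ≡ 2 * (q * x) * T
            lem = solve-∀
          by-cases : ∀ b → suc P ≡ 2 * q ^ suc b → suc P ≡ 2 * q × 2 * T′ ≡ G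
          by-cases zero e = trans e (cong (2 *_) (*-identityʳ q)) , trans (sym (*-identityˡ (2 * T′))) (cancelled 0 e)
          -- A higher exponent would leave the odd prime q dividing G, a power of 2.
          by-cases (suc b) e with f , G≡ ← product-E I = contradiction
            (subst (2 ∣_) (sym (prime∣prime qpr prime[2] (prime∣^ 2 f qpr (subst (q ∣_) (trans (cancelled (suc b) e) G≡) (∣m⇒∣m*n (2 * T′) (m∣m*n (q ^ b))))))) ∣-refl) oddq

        mersenne : ∀ {R} → R ∈ Ps′ → ∃ λ a → suc R ≡ 2 ^ a
        mersenne R∈ with f , G≡ ← product-E I =
          ∣p^n prime[2] f (subst (_ ∣_) (trans (proj₂ split) G≡) (∣n⇒∣m*n 2 (∈⇒∣product (∈-map⁺ suc R∈))))

        -- As R ≥ 2, the exponent in R + 1 = 2^a is at least 2, so R ≡ 3 (mod 4).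
        mersenne-mod4 : ∀ {R} → R ∈ Ps′ → R % 4 ≢ 1
        mersenne-mod4 {R} R∈ e with mersenne R∈
        ... | zero , eR = contradiction (subst (2 ≤_) (suc-injective eR) (2≤component (All.lookup comps (∈-resp-↭ (↭-sym perm) (there R∈))))) λ ()
        ... | suc zero , eR = contradiction (subst (2 ≤_) (suc-injective eR) (2≤component (All.lookup comps (∈-resp-↭ (↭-sym perm) (there R∈))))) λ { (s≤s ()) }
        ... | suc (suc a) , eR = contradiction (trans (sym (mod-suc 4 R e)) (trans (cong (_% 4) eR) (n∣m⇒m%n≡0 _ 4 (*-pres-∣ {p = 2} (∣-refl {2}) (m∣m*n (2 ^ a)))))) λ ()

        -- Each index in `I` yields a component ≡ 1 (mod 4), which can only be `P`. So `p` divides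
        -- both Fermat numbers, and these are coprime for different indices.
        no-other-index : ∀ {i′} → i′ ∈ I → i′ ≡ i
        no-other-index {i′} i′∈ with p′ , pr′ , p′∣ ← prime-divisor (suc (E i′)) (s≤s (0<E i′))
          with j′ , P′∈ ← part-of-index pr′ i′∈ p′∣ with ∈-resp-↭ perm P′∈
        ... | there P′∈′ = contradiction (index-part-mod4 {j = j′} pr′ i′∈ p′∣ P′∈) (mersenne-mod4 P′∈′)
        ... | here P′≡P with refl ← component-base {i = j′} {j} pr′ pr P′≡P with <-cmp i′ i
        ...   | tri< i′<i _ _ = contradiction p∣ (fermat-coprime pr i′<i p′∣)
        ...   | tri≈ _ i′≡i _ = i′≡i
        ...   | tri> _ _ i<i′ = contradiction p′∣ (fermat-coprime pr i<i′ p∣)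

        singleton-index : I ≡ i ∷ []
        singleton-index = go I uI i∈ no-other-index
          where
          go : ∀ J → Unique J → i ∈ J → (∀ {i′} → i′ ∈ J → i′ ≡ i) → J ≡ i ∷ []
          go (x ∷ []) _ _ h = cong (_∷ []) (h (here refl))
          go (x ∷ y ∷ J) ((x≢y ∷ _) ∷ _) _ h = contradiction (trans (h (here refl)) (sym (h (there (here refl))))) x≢y

        M = product Ps′

        -- Modulo 3 the equation (1 + q) (1 + E i) = 2 (2q - 1) M forces M ≡ 2.
        M-equation : suc q * suc (E i) ≡ 2 * (P * M)
        M-equation = trans (cong₂ _*_ (cong suc (sym Q≡q)) (trans (sym (*-identityʳ (suc (E i)))) (cong (λ J → product (map fermat J)) (sym singleton-index))))
          (trans eq₂ (cong (2 *_) (trans N≡ (product-↭ perm))))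

        M-mod3 : NotTwoMod3 M
        M-mod3 = product-NotTwoMod3 (All.tabulate λ R∈ → let a , e = mersenne R∈ in mersenne-mod3 {a = a} e)

        E-mod3 : suc (E i) % 3 ≡ 2
        E-mod3 = mod-suc 3 (E i) (lem i 1≤i)
          where
          lem : ∀ i → 1 ≤ i → E i % 3 ≡ 1
          lem (suc i) _ = trans (cong (_% 3) (^-2^suc 2 i)) (∤⇒square-mod3 (E i) λ d → from-no (3 ∣? 2) (prime∣^ 2 (2 ^ i) prime[3] d))

        simple-exponent-impossible : ⊥
        simple-exponent-impossible = mod3-clash {q} {P} (proj₁ split) 3∤P E-mod3 M-mod3 M-equation
          where
          3∤P : P % 3 ≢ 0
          -- Otherwise `p` = 3, contrary to `p` ≡ 1 (mod 4).
          3∤P m = contradiction (subst (λ p → p % 4 ≡ 1) (sym (prime∣prime prime[3] pr (prime∣^ p (2 ^ j) prime[3] (m%n≡0⇒n∣m P 3 m)))) p-mod4) λ ()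

  no-positive-index : ∀ {i} → i ∈ I → ¬ 1 ≤ i
  no-positive-index {i} i∈ 1≤i = by-exponent l refl
    where
    by-exponent : ∀ k → l ≡ k → ⊥
    by-exponent (suc _) l≡ = square-exponent-impossible l≡
    by-exponent zero l≡ with p , pr , p∣ ← prime-divisor (suc (E i)) (s≤s (0<E i))
      with j , P∈ ← part-of-index pr i∈ p∣ with _ , perm , _ ← remove P∈ uPs =
        simple-exponent-impossible l≡ {j = j} i∈ 1≤i pr p∣ P∈ perm

  oddQ : Odd Q
  oddQ h = oddq (prime∣^ q (2 ^ l) prime[2] h)

  -- Only the index 0 is left. An empty `I` would make σ∞ N equal to the odd number Q > 1, whereas
  -- every component of N contributes an even factor.
  I≡[0] : I ≡ 0 ∷ []
  I≡[0] = go I uI no-positive-index eq₁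
    where
    go : ∀ J → Unique J → (∀ {i} → i ∈ J → ¬ 1 ≤ i) → product (map suc Ps) ≡ Q * product (map E J) → J ≡ 0 ∷ []
    go (0 ∷ []) _ _ _ = refl
    go (suc _ ∷ _) _ h _ = contradiction (s≤s z≤n) (h (here refl))
    go (0 ∷ suc _ ∷ _) _ h _ = contradiction (s≤s z≤n) (h (there (here refl)))
    go (0 ∷ 0 ∷ _) ((0≢0 ∷ _) ∷ _) _ _ = contradiction refl 0≢0
    go [] _ _ e = no-parts Ps odd-part (trans e (*-identityʳ Q))
      where
      no-parts : ∀ Rs → (∀ {R} → R ∈ Rs → Odd R) → product (map suc Rs) ≡ Q → [] ≡ 0 ∷ []
      no-parts [] _ e = contradiction (subst (q ∣_) (sym e) (∣^≢0 q (2 ^ l) (2^≢0 l))) (∣1-prime qpr)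
      no-parts (R ∷ Rs) o e = contradiction (subst (2 ∣_) e (∣m⇒∣m*n (product (map suc Rs)) (odd⇒2∣suc (o (here refl))))) oddQ

  -- Now σ∞ N = 2 Q is not divisible by 4, so N is a single component. Then 1 + N = 2 Q and 3 (1 +
  -- Q) = 2 N give Q = 5 and N = 9.
  N≡9 : N ≡ 9
  N≡9 = go Ps odd-part N≡ (trans eq₁ (cong (λ J → Q * product (map E J)) I≡[0])) (trans (cong (λ J → suc Q * product (map fermat J)) (sym I≡[0])) eq₂)
    where
    go : ∀ Rs → (∀ {R} → R ∈ Rs → Odd R) → N ≡ product Rs → product (map suc Rs) ≡ Q * 2 → suc Q * 3 ≡ 2 * N → N ≡ 9
    go [] _ _ e _ = contradiction (divides Q e) (from-no (2 ∣? 1))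
    go (R ∷ R′ ∷ Rs) o _ e _ = contradiction (*-cancelʳ-∣ 2 (subst (4 ∣_) e (*-pres-∣ (odd⇒2∣suc (o (here refl))) (∣m⇒∣m*n (product (map suc Rs)) (odd⇒2∣suc (o (there (here refl)))))))) oddQ
    go (R ∷ []) _ N≡R e₁ e₂ = *-cancelˡ-≡ N 9 2 (trans (sym e₂) (cong (λ Q → suc Q * 3) Q≡5))
      where
      Q≡5 : Q ≡ 5
      -- Elimination of N without subtraction: 4 Q + 3 = 2 (1 + N) + 3 = 5 + 2 N = 5 + 3 (1 + Q).
      Q≡5 = +-cancelˡ-≡ (3 + 3 * Q) Q 5 (trans (lem₁ Q) (trans (cong (λ z → 2 * z + 3) (trans (sym e₁) (*-identityʳ (suc R))))
              (trans (lem₂ R) (trans (cong (5 +_) (trans (cong (2 *_) (sym (trans N≡R (*-identityʳ R)))) (sym e₂))) (lem₃ Q)))))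
        where
        lem₁ : ∀ Q → 3 + 3 * Q + Q ≡ 2 * (Q * 2) + 3
        lem₁ = solve-∀
        lem₂ : ∀ R → 2 * suc R + 3 ≡ 5 + 2 * R
        lem₂ = solve-∀
        lem₃ : ∀ Q → 5 + suc Q * 3 ≡ 3 + 3 * Q + 5
        lem₃ = solve-∀

-- Conclusion for N and the value at 9

superperfect⇒9 : (N : ℕ) → 0 < N → ¬ 2 ∣ N → σ∞ (σ∞ N) ≡ 2 * N → N ≡ 9
superperfect⇒9 N 0<N oddN e = from-one-odd (one-odd CM.comps CM.unique oddN (trans (sym CM.σ∞-prod) e))
  where
  module CN = Components (components N 0<N)
  0<M : 0 < σ∞ N
  0<M = subst (0 <_) (sym CN.σ∞-prod) (0<product-suc CN.parts)
    where
    0<product-suc : ∀ xs → 0 < product (map suc xs)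
    0<product-suc [] = z<s
    0<product-suc (x ∷ xs) = 0<* {suc x} z<s (0<product-suc xs)
  module CM = Components (components (σ∞ N) 0<M)
  from-one-odd : OneOdd CM.parts → N ≡ 9
  from-one-odd record { Q = _ ; I = I ; compQ = q , l , qpr , refl ; oddQ = oddQ ; uI = uI ; perm = perm } =
    Core.N≡9 oddN CN.comps CN.unique CN.prod {q} {l} qpr (λ 2∣q → oddQ (∣-trans 2∣q (∣^≢0 q (2 ^ l) (2^≢0 l)))) uI
      (trans (sym CN.σ∞-prod) (trans CM.prod (product-↭ perm)))
      (trans (cong (λ xs → suc (q ^ (2 ^ l)) * product xs) (map-∘ I)) (trans (sym (product-map-↭ suc perm)) (trans (sym CM.σ∞-prod) e)))

theorem1p1 : ((N : ℕ) → 0 < N → ¬ (2 ∣ N) → σ∞ (σ∞ N) ≡ 2 * N → N ≡ 9)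
    × (σ∞ (σ∞ 9) ≡ 2 * 9)
-- The second half is settled by evaluation: σ∞ 9 = 10 and σ∞ 10 = 18.
theorem1p1 = superperfect⇒9 , refl
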